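{- Let $\pi$ be a set partition with $\mathrm{pm}(\pi)\geq 1$. Then there exists a constant $c_2(\pi)$ such that for all positive integers $n$, \[B_n(\pi)\leq c_2(\pi)^n\, n^{n\left(1-\frac{1}{\mathrm{pm}(\pi)}\right)}.\] If $\mathrm{pm}(\pi)=0$, then there exists a constant $c_2(\pi)$ such that $B_n(\pi)\leq c_2(\pi)^n$ for all $n$.
   Context: A set partition of $[N]$ is a partition of $[N]$ into nonempty unordered blocks. A set partition $\pi$ of $[N]$ contains a set partition $\pi'$ of $[M]$ if there is $S\subseteq[N]$, $|S|=M$, such that the restriction of $\pi$ to $S$, transported to $[M]$ via the order-preserving bijection $S\to[M]$, equals $\pi'$; otherwise $\pi$ avoids $\pi'$. $B_n(\pi)$ denotes the number of set partitions of $[n]$ avoiding $\pi$. For permutations $\sigma_1,\ldots,\sigma_d$ of $[m]$, $[\sigma_1,\ldots,\sigma_d]$ is the set partition of $[(d+1)m]$ with blocks $T_i=\{i,m+\sigma_1(i),2m+\sigma_2(i),\ldots,dm+\sigma_d(i)\}$, $i\in[m]$ (for $d=0$ this is the partition of $[m]$ into singletons). The permutability $\mathrm{pm}(\pi)$ of a set partition $\pi$ is the minimum $d\ge 0$ such that there exist $m$ and permutations $\sigma_1,\ldots,\sigma_d\in S_m$ with $[\sigma_1,\ldots,\sigma_d]$ containing $\pi$. -}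

module Defs where

open import Data.Nat using (ℕ; zero; suc; _*_; _<_)
open import Data.Bool using (Bool; true; false; _∧_; not; T)
open import Data.Fin using (Fin; zero; suc; remQuot; _≟_)
open import Data.Fin.Permutation using (Permutation′; _⟨$⟩ˡ_)
open import Data.List using (List; []; _∷_; map; concatMap; length; filter; allFin)
open import Data.Bool.ListAction using (all; any)
open import Data.Vec using (Vec; []; _∷_; lookup)
open import Data.Product using (Σ; _×_; _,_)
open import Relation.Nullary using (¬_; does)
open import Relation.Nullary.Decidable using (T?)

-- A set partition of [n] is represented by its "same block" relation,
-- a Bool-valued relation on Fin n that is an equivalence relation.

Rel : ℕ → Set
Rel n = Fin n → Fin n → Bool

allF : ∀ {n} → (Fin n → Bool) → Bool
allF {n} p = all p (allFin n)

_⇒b_ : Bool → Bool → Bool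
true ⇒b b = b
false ⇒b _ = true

_==b_ : Bool → Bool → Bool
true ==b b = b
false ==b b = not b

isEquiv : ∀ {n} → Rel n → Bool
isEquiv R =
  allF (λ i → R i i) ∧
  (allF (λ i → allF (λ j → R i j ⇒b R j i)) ∧
   allF (λ i → allF (λ j → allF (λ k → (R i j ∧ R j k) ⇒b R i k))))

SetPartition : ℕ → Set
SetPartition n = Σ (Rel n) (λ R → T (isEquiv R))

-- Order-preserving injections Fin M → Fin N (thinnings); these are in
-- bijection with subsets S ⊆ [N] of size M, `embed` being the
-- order-preserving bijection [M] → S.

data Thin : ℕ → ℕ → Set where
  done : Thin zero zero
  keep : ∀ {M N} → Thin M N → Thin (suc M) (suc N)
  drop : ∀ {M N} → Thin M N → Thin M (suc N)

embed : ∀ {M N} → Thin M N → Fin M → Fin N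
embed (keep θ) zero    = zero
embed (keep θ) (suc i) = suc (embed θ i)
embed (drop θ) i       = suc (embed θ i)

allThins : ∀ M N → List (Thin M N)
allThins zero    zero    = done ∷ []
allThins (suc M) zero    = []
allThins zero    (suc N) = map drop (allThins zero N)
allThins (suc M) (suc N) = map keep (allThins M N) Data.List.++ map drop (allThins (suc M) N)

contains : ∀ {N M} → Rel N → Rel M → Bool
contains {N} {M} R P =
  any (λ θ → allF (λ i → allF (λ j → R (embed θ i) (embed θ j) ==b P i j)))
      (allThins M N)

Contains : ∀ {N M} → Rel N → Rel M → Set
Contains R P = T (contains R P)

allVecs : ∀ k → List (Vec Bool k)
allVecs zero    = [] ∷ []
allVecs (suc k) = concatMap (λ v → (true ∷ v) ∷ (false ∷ v) ∷ []) (allVecs k)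

allVecVecs : ∀ k l → List (Vec (Vec Bool l) k)
allVecVecs zero    l = [] ∷ []
allVecVecs (suc k) l =
  concatMap (λ rest → map (λ row → row ∷ rest) (allVecs l)) (allVecVecs k l)

allRels : ∀ n → List (Rel n)
allRels n = map (λ m i j → lookup (lookup m i) j) (allVecVecs n n)

B : ∀ {M} → ℕ → Rel M → ℕ
B n π = length (filter (λ R → T? (isEquiv R ∧ not (contains R π))) (allRels n))

-- The set partition [σ₁,…,σ_d] of [(d+1)m]: position k·m + r (layer k,
-- offset r, 0-based) lies in block T_i where i = r for k = 0 and
-- σ_k(i) = r, i.e. i = σ_k⁻¹(r), for k ≥ 1.

blockLabel : ∀ {d m} → Vec (Permutation′ m) d → Fin (suc d * m) → Fin m
blockLabel {d} {m} σs p with remQuot {suc d} m p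
... | zero  , r = r
... | suc k , r = lookup σs k ⟨$⟩ˡ r

permPartition : ∀ {d m} → Vec (Permutation′ m) d → Rel (suc d * m)
permPartition σs p q = does (blockLabel σs p ≟ blockLabel σs q)

PermContains : ∀ {M} → Rel M → ℕ → Set
PermContains π d = Σ ℕ (λ m → Σ (Vec (Permutation′ m) d) (λ σs → Contains (permPartition σs) π))

IsPm : ∀ {M} → Rel M → ℕ → Set
IsPm π d = PermContains π d × (∀ d′ → d′ < d → ¬ PermContains π d′)

-- Suppose [σ₁,…,σ_d] contains π, and let the partition of [n] avoid π; put D = d + 1.
--
-- Extremal bound.  A set of cells of [K]^t in which no choice of D coordinates carries a given D-dimensional
-- permutation pattern has O(K^(D-1)) elements: contract by a constant factor s; cells of the contraction with
-- few preimages are handled by induction on K, and those whose preimages spread out in some direction c by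
-- induction on D, because there the order in direction c can be prescribed at will.
--
-- Hypergraphs.  Cut every edge of a simple hypergraph on [K] into consecutive pieces of D·m vertices.  A piece
-- shared by m edges, or a pattern among the pieces, gives the pattern in the hypergraph: two pieces of one edge
-- cannot both cross the gap between consecutive layers.  Hence the edges have total size O(K^d).
--
-- Encoding.  Merge the points of [n] into K ≈ n^(1/d) intervals of length ℓ ≈ n^(1-1/d) and encode the shadows
-- of the blocks on the intervals by passing from scale to scale: going from 2^a to 2^(a+1) costs a number of
-- bits proportional to the total size of the edges, and the geometric sum of these costs is O(K^d) = O(n).
-- An interval meets at most ℓ blocks, so given the shadows the partition is determined by ℓ^n further choices.

module Submission where

-- The extremal bound lives in D·m coordinates although the pattern uses only D of them: a piece of
-- an edge is recorded with all its vertices, because it is not known in advance which ones will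
-- serve as the layers. The exponent depends only on the number of coordinates in the pattern; the
-- number of coordinates of the points enters the constant alone. Pieces have D·m vertices so that
-- one piece shared by m edges already has room for the whole pattern. The obstacle in the encoding
-- is a logarithm. Listing O(n) vertices of the shadows by name costs about log n bits each, that is
-- a factor n^(O(n)), which would destroy the exponent. Halving spends a bounded number of bits per
-- vertex at each scale, and the scales form a geometric series dominated by the finest one. The
-- finest scale is treated apart. Different blocks may have the same shadow there and must be kept
-- apart, so the shadows form a list with repetitions. Its total size is bounded by n through the
-- disjointness of the blocks; avoidance controls only the coarser scales, where shadows are taken
-- without repetition.

open import Defs
import Data.Bool as Bool
open import Data.Bool using (Bool; true; false; T; not; _∧_)
open import Data.Empty using (⊥-elim)
open import Data.Fin as Fin using (Fin; zero; suc; toℕ; fromℕ<)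
import Data.Fin.Properties as Fin
open import Data.List using
  ( List; []; _∷_; [_]; _++_; map; concat; concatMap; length; filter; deduplicate; allFin; upTo; lookup
  ; cartesianProductWith; cartesianProduct; take; replicate
  )
open import Data.Nat.ListAction using (sum)
import Data.List as List
import Data.List.Properties as List
open import Data.List.Properties using
  ( length-++; length-map; length-upTo; map-++; ++-assoc; length-replicate; length-tabulate
  )
open import Data.List.Membership.Propositional using (_∈_; find; lose)
open import Data.List.Membership.Propositional.Properties
open import Data.List.Relation.Binary.Permutation.Propositional using (_↭_; ↭-refl; ↭-sym; ↭-trans; prep)
import Data.List.Relation.Binary.Permutation.Propositional.Properties as ↭
open import Data.List.Relation.Unary.All as All using (All; []; _∷_)
import Data.List.Relation.Unary.All.Properties as All
open import Data.List.Relation.Unary.AllPairs as AllPairs using (AllPairs; []; _∷_)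
import Data.List.Relation.Unary.AllPairs.Properties as AllPairs
open import Data.List.Relation.Unary.Any as Any using (Any; here; there; any?)
import Data.List.Relation.Unary.Any.Properties as Any
open import Data.List.Relation.Unary.Unique.Propositional using (Unique)
import Data.List.Relation.Unary.Unique.Propositional.Properties as Unique
import Data.List.Relation.Unary.Unique.DecPropositional.Properties as DecUnique
open import Data.Nat
open import Data.Nat.DivMod
open import Data.Nat.Properties
open import Data.Nat.Tactic.RingSolver using (solve-∀)
open import Data.Product using (Σ; ∃; _×_; _,_; proj₁; proj₂)
open import Data.Sum using (_⊎_; inj₁; inj₂)
open import Data.Vec as Vec using (Vec; []; _∷_)
import Data.Vec.Properties as Vec
open import Function using (_∘_; id)
open import Relation.Binary using (DecidableEquality; tri<; tri≈; tri>)
open import Relation.Binary.PropositionalEquality hiding ([_])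
open import Relation.Nullary using (¬_; Dec; yes; no; does; contradiction; ¬?)
open import Relation.Unary using (Decidable)
open import Data.List.Membership.DecPropositional _≟_ using (_∈?_)
open import Data.Bool.Properties using (T-∧; T-≡)
open import Data.Fin.Permutation using (Permutation′; _⟨$⟩ʳ_; inverseʳ)
open import Function.Bundles using (Equivalence)
open import Relation.Nullary.Decidable using (T?; dec-true; dec-false; _×-dec_; _→-dec_)

-- Counting in lists

private variable
  A A′ : Set

length-split : ∀ {P : A → Set} (P? : Decidable P) xs →
  length xs ≡ length (filter P? xs) + length (filter (¬? ∘ P?) xs)
length-split P? [] = refl
length-split P? (x ∷ xs) with P? x
... | yes _ = cong suc (length-split P? xs)
... | no  _ = trans (cong suc (length-split P? xs)) (sym (+-suc _ _))

length-filter-filter : ∀ {P Q : A → Set} (P? : Decidable P) (Q? : Decidable Q) xs →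
  length (filter P? (filter Q? xs)) ≤ length (filter P? xs)
length-filter-filter P? Q? [] = z≤n
length-filter-filter P? Q? (x ∷ xs) with Q? x
... | no _ with P? x
...   | yes _ = m≤n⇒m≤1+n (length-filter-filter P? Q? xs)
...   | no  _ = length-filter-filter P? Q? xs
length-filter-filter P? Q? (x ∷ xs) | yes _ with P? x
...   | yes _ = s≤s (length-filter-filter P? Q? xs)
...   | no  _ = length-filter-filter P? Q? xs

-- Each `x` is charged to the first `y` related to it. A relation is used instead of a map because a
-- wide cell can match many keys and a block can meet an interval in several points.
length≤fibres : ∀ {R : A → A′ → Set} (R? : ∀ x y → Dec (R x y)) N xs ys →
  (∀ {x} → x ∈ xs → Any (R x) ys) →
  (∀ {y} → y ∈ ys → length (filter (λ x → R? x y) xs) ≤ N) →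
  length xs ≤ N * length ys
length≤fibres R? N [] [] cover fibre = z≤n
length≤fibres R? N (x ∷ xs) [] cover fibre with () ← cover (here refl)
length≤fibres {R = R} R? N xs (y ∷ ys) cover fibre = begin
  length xs                                       ≡⟨ length-split (λ x → R? x y) xs ⟩
  length (filter (λ x → R? x y) xs) + length rest ≤⟨ +-mono-≤ (fibre (here refl))
    (length≤fibres R? N rest ys cover′ fibre′) ⟩
  N + N * length ys                               ≡⟨ *-suc N (length ys) ⟨
  N * suc (length ys)                             ∎
  where
  open ≤-Reasoning
  rest = filter (λ x → ¬? (R? x y)) xs
  cover′ : ∀ {x} → x ∈ rest → Any (R x) ys
  cover′ {x} x∈ with ∈-filter⁻ (λ x → ¬? (R? x y)) {xs = xs} x∈
  ... | x∈xs , ¬r with cover x∈xs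
  ...   | here r = contradiction r ¬r
  ...   | there a = a
  fibre′ : ∀ {y′} → y′ ∈ ys → length (filter (λ x → R? x y′) rest) ≤ N
  fibre′ {y′} y′∈ = ≤-trans (length-filter-filter (λ x → R? x y′) (λ x → ¬? (R? x y)) xs) (fibre (there y′∈))

length-mono-⊆ : ∀ {xs ys : List A} → Unique xs → (∀ {x} → x ∈ xs → x ∈ ys) → length xs ≤ length ys
length-mono-⊆ [] sub = z≤n
length-mono-⊆ {xs = x ∷ xs} {ys} (x∉ ∷ uxs) sub with ∈-∃++ (sub (here refl))
... | as , bs , refl = begin
  suc (length xs)                  ≤⟨ s≤s (length-mono-⊆ uxs sub′) ⟩
  suc (length (as ++ bs))          ≡⟨ cong suc (length-++ as) ⟩
  suc (length as + length bs)      ≡⟨ +-suc (length as) (length bs) ⟨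
  length as + suc (length bs)      ≡⟨ length-++ as ⟨
  length (as ++ x ∷ bs)            ∎
  where
  open ≤-Reasoning
  sub′ : ∀ {y} → y ∈ xs → y ∈ as ++ bs
  sub′ y∈ with ∈-++⁻ as (sub (there y∈))
  ... | inj₁ y∈as = ∈-++⁺ˡ y∈as
  ... | inj₂ (here refl) = contradiction refl (All.lookup x∉ y∈)
  ... | inj₂ (there y∈bs) = ∈-++⁺ʳ as y∈bs

length-cartesianProductWith : ∀ {C : Set} (f : A → A′ → C) xs ys →
  length (cartesianProductWith f xs ys) ≡ length xs * length ys
length-cartesianProductWith f [] ys = refl
length-cartesianProductWith f (x ∷ xs) ys = trans (length-++ (map (f x) ys))
  (cong₂ _+_ (length-map (f x) ys) (length-cartesianProductWith f xs ys))

box : ∀ {t} → (Fin t → List A) → List (Vec A t)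
box {t = zero}  V = [ [] ]
box {t = suc t} V = cartesianProductWith _∷_ (V zero) (box (V ∘ suc))

length-box : ∀ {t} (V : Fin t → List A) k → (∀ j → length (V j) ≤ k) → length (box V) ≤ k ^ t
length-box {t = zero}  V k V≤ = ≤-refl
length-box {t = suc t} V k V≤ = ≤-trans
  (≤-reflexive (length-cartesianProductWith _∷_ (V zero) (box (V ∘ suc))))
  (*-mono-≤ (V≤ zero) (length-box (V ∘ suc) k (V≤ ∘ suc)))

∈-box : ∀ {t} (V : Fin t → List A) (v : Vec A t) → (∀ j → Vec.lookup v j ∈ V j) → v ∈ box V
∈-box V [] v∈ = here refl
∈-box V (x ∷ v) v∈ = ∈-cartesianProductWith⁺ _∷_ (v∈ zero) (∈-box (V ∘ suc) v (v∈ ∘ suc))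

vectors : List A → ∀ t → List (Vec A t)
vectors xs t = box {t = t} (λ _ → xs)

length-vectors : ∀ (xs : List A) t → length (vectors xs t) ≤ length xs ^ t
length-vectors xs t = length-box {t = t} (λ _ → xs) (length xs) (λ _ → ≤-refl)

Sorted : List ℕ → Set
Sorted = AllPairs _<_

lookup-AllPairs : ∀ {R : A → A → Set} {xs} → AllPairs R xs → ∀ {i j} → i Fin.< j → R (lookup xs i) (lookup xs j)
lookup-AllPairs (r ∷ rs) {zero}  {suc j} _       = All.lookup r (∈-lookup j)
lookup-AllPairs (r ∷ rs) {suc i} {suc j} (s≤s p) = lookup-AllPairs rs p

Sorted⇒Unique : ∀ {xs} → Sorted xs → Unique xs
Sorted⇒Unique = AllPairs.map <⇒≢

Sorted-upTo : ∀ n → Sorted (upTo n)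
Sorted-upTo n = AllPairs.applyUpTo⁺₁ id n (λ i<j _ → i<j)

Sorted-ext : ∀ {xs ys} → Sorted xs → Sorted ys → (∀ {z} → z ∈ xs → z ∈ ys) → (∀ {z} → z ∈ ys → z ∈ xs) → xs ≡ ys
Sorted-ext [] [] _ _ = refl
Sorted-ext [] (_ ∷ _) _ g with () ← g (here refl)
Sorted-ext (_ ∷ _) [] f _ with () ← f (here refl)
Sorted-ext {x ∷ xs} {y ∷ ys} (x< ∷ sxs) (y< ∷ sys) f g = cong₂ _∷_ x≡y (Sorted-ext sxs sys f′ g′)
  where
  x≡y : x ≡ y
  x≡y with f (here refl) | g (here refl)
  ... | here eq  | _        = eq
  ... | there _  | here eq  = sym eq
  ... | there p  | there q  = contradiction (All.lookup x< q) (<-asym (All.lookup y< p))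
  f′ : ∀ {z} → z ∈ xs → z ∈ ys
  f′ z∈ with f (there z∈)
  ... | here refl = contradiction x≡y (<⇒≢ (All.lookup x< z∈))
  ... | there p   = p
  g′ : ∀ {z} → z ∈ ys → z ∈ xs
  g′ z∈ with g (there z∈)
  ... | here refl = contradiction (sym x≡y) (<⇒≢ (All.lookup y< z∈))
  ... | there p   = p

AllPairs-deduplicate : ∀ {R S : A → A → Set} (R? : ∀ x y → Dec (R x y)) {xs} →
  AllPairs S xs → AllPairs S (deduplicate R? xs)
AllPairs-deduplicate R? [] = []
AllPairs-deduplicate R? (s ∷ ss) =
  All.filter⁺ _ (All.deduplicate⁺ R? s) ∷ AllPairs.filter⁺ _ (AllPairs-deduplicate R? ss)

deduplicate-distinct : ∀ {R : A → A → Set} (R? : ∀ x y → Dec (R x y)) xs →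
  AllPairs (λ x y → ¬ R x y) (deduplicate R? xs)
deduplicate-distinct R? [] = []
deduplicate-distinct R? (x ∷ xs) =
  All.all-filter _ (deduplicate R? xs) ∷ AllPairs.filter⁺ _ (deduplicate-distinct R? xs)

deduplicate-covers : ∀ {R : A → A → Set} (R? : ∀ x y → Dec (R x y)) → (∀ {x} → R x x) →
  (∀ {x y z} → R x y → R y z → R x z) → ∀ {x} xs → x ∈ xs → Any (λ y → R y x) (deduplicate R? xs)
deduplicate-covers R? ρ τ (y ∷ ys) (here refl) = here ρ
deduplicate-covers {R = R} R? ρ τ {x} (y ∷ ys) (there x∈) with find (deduplicate-covers R? ρ τ ys x∈)
... | z , z∈ , Rzx with R? y z
...   | yes Ryz = here (τ Ryz Rzx)
...   | no ¬Ryz = there (lose (∈-filter⁺ (¬? ∘ R? y) z∈ ¬Ryz) Rzx)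

lookup-injective : ∀ {xs : List A} → Unique xs → ∀ i j → lookup xs i ≡ lookup xs j → i ≡ j
lookup-injective uxs i j eq with Fin.<-cmp i j
... | tri< lt _ _  = contradiction eq (lookup-AllPairs uxs lt)
... | tri≈ _ i≡j _ = i≡j
... | tri> _ _ gt  = contradiction (sym eq) (lookup-AllPairs uxs gt)

-- The multidimensional Marcus–Tardos theorem

countTrue : ∀ {t} → Vec Bool t → ℕ
countTrue [] = 0
countTrue (true ∷ S)  = suc (countTrue S)
countTrue (false ∷ S) = countTrue S

countTrue-insert : ∀ {t} (S : Vec Bool t) c → Vec.lookup S c ≡ false →
  countTrue (S Vec.[ c ]≔ true) ≡ suc (countTrue S)
countTrue-insert (false ∷ S) zero    _  = refl
countTrue-insert (true ∷ S)  (suc c) eq = cong suc (countTrue-insert S c eq)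
countTrue-insert (false ∷ S) (suc c) eq = countTrue-insert S c eq

insert-⊒ : ∀ {t} (S : Vec Bool t) c j → Vec.lookup S j ≡ true → Vec.lookup (S Vec.[ c ]≔ true) j ≡ true
insert-⊒ (_ ∷ S) zero    zero    eq = refl
insert-⊒ (_ ∷ S) zero    (suc j) eq = eq
insert-⊒ (_ ∷ S) (suc c) zero    eq = eq
insert-⊒ (_ ∷ S) (suc c) (suc j) eq = insert-⊒ S c j eq

_⊑_ : ∀ {t} → Vec Bool t → Vec Bool t → Set
Z ⊑ S = ∀ j → Vec.lookup Z j ≡ true → Vec.lookup S j ≡ true

InBox : ∀ {t} → ℕ → List (Vec ℕ t) → Set
InBox K A = ∀ {x} → x ∈ A → ∀ j → Vec.lookup x j < K

vec-ext : ∀ {A : Set} {t} (x y : Vec A t) → (∀ j → Vec.lookup x j ≡ Vec.lookup y j) → x ≡ y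
vec-ext x y eq = trans (sym (Vec.tabulate∘lookup x)) (trans (Vec.tabulate-cong eq) (Vec.tabulate∘lookup y))

^-distribʳ-* : ∀ n a b → (a * b) ^ n ≡ a ^ n * b ^ n
^-distribʳ-* zero    a b = refl
^-distribʳ-* (suc n) a b = trans (cong (a * b *_) (^-distribʳ-* n a b)) (interchange a b (a ^ n) (b ^ n))
  where
  interchange : ∀ a b c d → a * b * (c * d) ≡ a * c * (b * d)
  interchange = solve-∀

power-bracket : ∀ b → 1 < b → ∀ n → 1 ≤ n → ∃ λ e → b ^ e ≤ n × n < b ^ suc e
power-bracket b 1<b (suc zero) _ = 0 , ≤-refl , ≤-trans 1<b (≤-reflexive (sym (*-identityʳ b)))
power-bracket b 1<b (suc n@(suc _)) _ with power-bracket b 1<b n (s≤s z≤n)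
... | e , lo , hi with suc n <? b ^ suc e
...   | yes lt = e , m≤n⇒m≤1+n lo , lt
...   | no ≮   = suc e , ≮⇒≥ ≮ , <-≤-trans (s≤s hi) (^-monoʳ-< b 1<b {suc e} ≤-refl)

length≤1 : ∀ {A : Set} {xs : List A} → Unique xs → (∀ {x y} → x ∈ xs → y ∈ xs → x ≡ y) → length xs ≤ 1
length≤1 [] _ = z≤n
length≤1 {xs = _ ∷ []} _ _ = s≤s z≤n
length≤1 {xs = _ ∷ _ ∷ _} ((x≢y ∷ _) ∷ _) eq = contradiction (eq (here refl) (there (here refl))) x≢y

vec-≟ : ∀ {t} → DecidableEquality (Vec ℕ t)
vec-≟ = Vec.≡-dec _≟_

-- When the pattern sits on the set S of coordinates, rk S j is the order it prescribes in coordinate j ∈ S.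
module MarcusTardos (t k′ : ℕ) (I : Set) (rk : Vec Bool t → Fin t → I → Fin (suc k′)) where

  k = suc k′
  Point = Vec ℕ t

  _!_ : ∀ {A : Set} → Vec A t → Fin t → A
  _!_ = Vec.lookup

  -- Z is the set of coordinates whose order has already been taken care of.
  Occurs : Vec Bool t → Vec Bool t → List Point → Set
  Occurs Z S A = Σ (I → Point) λ x → (∀ i → x i ∈ A) ×
    (∀ j → Z ! j ≡ false → S ! j ≡ true → ∀ i i′ → rk S j i Fin.< rk S j i′ → x i ! j < x i′ ! j)

  -- `S` is the whole set of pattern coordinates, `Z` included: `rk` looks at all of `S`, since the
  -- layer that a coordinate plays is its position in `S`. A settled coordinate moves into `Z` but
  -- stays in `S`, and `D` counts the coordinates still to be chosen.
  Avoids : Vec Bool t → ℕ → List Point → Set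
  Avoids Z D A = ∀ S → Z ⊑ S → countTrue S ≡ countTrue Z + D → ¬ Occurs Z S A

  -- This keeps settled coordinates harmless: they show a single value, or a single residue in a
  -- cell, and so never count as spread out.
  Constant : Vec Bool t → List Point → Set
  Constant Z A = ∀ {x y} → x ∈ A → y ∈ A → ∀ j → Z ! j ≡ true → x ! j ≡ y ! j

  module Scaled (s : ℕ) ⦃ _ : NonZero s ⦄ (s-large : k ^ t * 2 ≤ s) where

    -- Only sides `s ^ e` occur, so that contraction by `s` stays inside the class. `C` is uniform
    -- in `Z`, because the induction on `D′` applies the bound with a larger `Z`.
    Bound : ℕ → ℕ → Set
    Bound D′ C = ∀ e Z A → Unique A → InBox (s ^ e) A → Constant Z A → Avoids Z (suc D′) A →
      length A ≤ C * (s ^ e) ^ D′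

    insert-other : ∀ {Z : Vec Bool t} {c j} → Z ! j ≡ false → (Z Vec.[ c ]≔ true) ! j ≡ true → j ≡ c
    insert-other {Z} {c} {j} Zj Sj with j Fin.≟ c
    ... | yes j≡c = j≡c
    ... | no  j≢c with () ← trans (sym Zj) (trans (sym (Vec.lookup∘updateAt′ j c j≢c Z)) Sj)

    insert-unchanged : ∀ {Z : Vec Bool t} {c j} → j ≢ c → (Z Vec.[ c ]≔ true) ! j ≡ Z ! j
    insert-unchanged {Z} {c} {j} j≢c = Vec.lookup∘updateAt′ j c j≢c Z

    column : ℕ → List Point → Fin t → List ℕ
    column K A c = filter (λ v → any? (λ x → x ! c ≟ v) A) (upTo K)

    column⁻ : ∀ {K A c v} → v ∈ column K A c → ∃ λ x → x ∈ A × x ! c ≡ v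
    column⁻ {K} {A} {c} v∈ = find (proj₂ (∈-filter⁻ (λ v → any? (λ x → x ! c ≟ v) A) {xs = upTo K} v∈))

    column⁺ : ∀ {K A x} c → InBox K A → x ∈ A → x ! c ∈ column K A c
    column⁺ {K} {A} c box x∈ = ∈-filter⁺ (λ v → any? (λ x → x ! c ≟ v) A) (∈-upTo⁺ (box x∈ c)) (lose x∈ refl)

    column-sorted : ∀ K A c → Sorted (column K A c)
    column-sorted K A c = AllPairs.filter⁺ _ (Sorted-upTo K)

    pick : (V : List ℕ) → k ≤ length V → Fin k → ℕ
    pick V k≤ i = lookup V (Fin.inject≤ i k≤)

    pick-∈ : ∀ V k≤ i → pick V k≤ i ∈ V
    pick-∈ V k≤ i = ∈-lookup (Fin.inject≤ i k≤)

    pick-mono : ∀ V k≤ → Sorted V → ∀ {i j} → i Fin.< j → pick V k≤ i < pick V k≤ j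
    pick-mono V k≤ srt {i} {j} i<j = lookup-AllPairs srt
      (subst₂ _<_ (sym (Fin.toℕ-inject≤ i k≤)) (sym (Fin.toℕ-inject≤ j k≤)) i<j)

    -- With one coordinate `c` still free, `k` values in direction `c` would suffice: handing them
    -- out by rank produces an occurrence. So every direction takes few values, and `A` lies in the
    -- product of these short columns.
    base : Bound 0 (k ^ t)
    base e Z A uA box con av = ≤-trans (length-mono-⊆ uA λ {x} x∈ → ∈-box V x λ c → column⁺ c box x∈)
      (≤-trans (length-box V k V≤) (≤-reflexive (sym (*-identityʳ _))))
      where
      V = column (s ^ e) A
      V≤ : ∀ c → length (V c) ≤ k
      V≤ c with Z ! c in Zc
      ... | true  = ≤-trans (length≤1 (Sorted⇒Unique (column-sorted (s ^ e) A c)) same) (s≤s z≤n)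
        where
        same : ∀ {v w} → v ∈ V c → w ∈ V c → v ≡ w
        same v∈ w∈ with column⁻ {s ^ e} {A} {c} v∈ | column⁻ {s ^ e} {A} {c} w∈
        ... | x , x∈ , refl | y , y∈ , refl = con x∈ y∈ c Zc
      ... | false with k ≤? length (V c)
      ...   | no ≰   = <⇒≤ (≰⇒> ≰)
      ...   | yes k≤ = contradiction (x , (λ i → proj₁ (proj₂ (witness i))) , order)
          (av S (insert-⊒ Z c) (trans (countTrue-insert Z c Zc) (sym (+-comm (countTrue Z) 1))))
        where
        S = Z Vec.[ c ]≔ true
        witness : ∀ i → ∃ λ x → x ∈ A × x ! c ≡ pick (V c) k≤ (rk S c i)
        witness i = column⁻ {s ^ e} {A} {c} (pick-∈ (V c) k≤ (rk S c i))
        x = λ i → proj₁ (witness i)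
        order : ∀ j → Z ! j ≡ false → S ! j ≡ true → ∀ i i′ → rk S j i Fin.< rk S j i′ → x i ! j < x i′ ! j
        order j Zj Sj i i′ lt with insert-other {Z} {c} Zj Sj
        ... | refl = subst₂ _<_ (sym (proj₂ (proj₂ (witness i)))) (sym (proj₂ (proj₂ (witness i′))))
                       (pick-mono (V c) k≤ (column-sorted (s ^ e) A c) lt)

    contract : Point → Point
    contract = Vec.map (_/ s)

    contract-! : ∀ x j → contract x ! j ≡ x ! j / s
    contract-! x j = Vec.lookup-map j (_/ s) x

    contract-reflects-< : ∀ x y j → contract x ! j < contract y ! j → x ! j < y ! j
    contract-reflects-< x y j lt rewrite contract-! x j | contract-! y j =
      ≰⇒> λ y≤x → <⇒≱ lt (/-monoˡ-≤ s y≤x)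

    unit-box : ∀ {A : List Point} → Unique A → InBox 1 A → length A ≤ 1
    unit-box {A} uA box = length≤1 uA λ {x} {y} x∈ y∈ → vec-ext x y λ j →
      trans (n<1⇒n≡0 (box x∈ j)) (sym (n<1⇒n≡0 (box y∈ j)))

    -- `ih` is the bound with one free coordinate less, for every side; `ih-e` has the same number
    -- of free coordinates as the goal, but the smaller side `s ^ e`.
    module Contraction (D′ C : ℕ) (ih : Bound D′ C) (C′ e : ℕ)
      (ih-e : ∀ Z A → Unique A → InBox (s ^ e) A → Constant Z A → Avoids Z (suc (suc D′)) A →
        length A ≤ C′ * (s ^ e) ^ suc D′)
      (Z : Vec Bool t) (A : List Point) (uA : Unique A) (box-A : InBox (s ^ suc e) A)
      (con : Constant Z A) (av : Avoids Z (suc (suc D′)) A) where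

      K = s ^ e

      H : List Point
      H = deduplicate vec-≟ (map contract A)

      uH : Unique H
      uH = DecUnique.deduplicate-! vec-≟ (map contract A)

      H⁻ : ∀ {h} → h ∈ H → ∃ λ x → x ∈ A × h ≡ contract x
      H⁻ h∈ = ∈-map⁻ contract (∈-deduplicate⁻ vec-≟ (map contract A) h∈)

      H⁺ : ∀ {x} → x ∈ A → contract x ∈ H
      H⁺ x∈ = ∈-deduplicate⁺ vec-≟ (∈-map⁺ contract x∈)

      box-H : InBox K H
      box-H h∈ j with H⁻ h∈
      ... | x , x∈ , refl rewrite contract-! x j = m<n*o⇒m/o<n (<-≤-trans (box-A x∈ j) (≤-reflexive (*-comm s K)))

      con-H : Constant Z H
      con-H h∈ h′∈ j Zj with H⁻ h∈ | H⁻ h′∈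
      ... | x , x∈ , refl | y , y∈ , refl rewrite contract-! x j | contract-! y j = cong (_/ s) (con x∈ y∈ j Zj)

      av-H : Avoids Z (suc (suc D′)) H
      av-H S Z⊑S cnt (y , y∈ , ord) = av S Z⊑S cnt ((λ i → proj₁ (H⁻ (y∈ i))) , (λ i → proj₁ (proj₂ (H⁻ (y∈ i)))) ,
        λ j Zj Sj i i′ lt → contract-reflects-< (proj₁ (H⁻ (y∈ i))) (proj₁ (H⁻ (y∈ i′))) j
          (subst₂ (λ a b → a ! j < b ! j) (proj₂ (proj₂ (H⁻ (y∈ i)))) (proj₂ (proj₂ (H⁻ (y∈ i′))))
            (ord j Zj Sj i i′ lt)))

      length-H : length H ≤ C′ * K ^ suc D′
      length-H = ih-e Z H uH box-H con-H av-H

      Residue : Point → Fin t → ℕ → Point → Set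
      Residue h c r x = contract x ≡ h × x ! c % s ≡ r

      residue? : ∀ h c r x → Dec (Residue h c r x)
      residue? h c r x = vec-≟ (contract x) h ×-dec (x ! c % s ≟ r)

      residues : Point → Fin t → List ℕ
      residues h c = filter (λ r → any? (residue? h c r) A) (upTo s)

      residues-sorted : ∀ h c → Sorted (residues h c)
      residues-sorted h c = AllPairs.filter⁺ _ (Sorted-upTo s)

      residues⁻ : ∀ h c {r} → r ∈ residues h c → ∃ λ x → x ∈ A × Residue h c r x
      residues⁻ h c r∈ = find (proj₂ (∈-filter⁻ (λ r → any? (residue? h c r) A) {xs = upTo s} r∈))

      residues⁺ : ∀ {x} → x ∈ A → ∀ c → x ! c % s ∈ residues (contract x) c
      residues⁺ {x} x∈ c = ∈-filter⁺ (λ r → any? (residue? (contract x) c r) A)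
        (∈-upTo⁺ (m%n<n (x ! c) s)) (lose x∈ (refl , refl))

      -- The threshold `k` provides one residue for each rank.
      Wide : Point → Fin t → Set
      Wide h c = Z ! c ≡ false × k ≤ length (residues h c)

      wide? : ∀ x → Dec (∃ λ c → Wide (contract x) c)
      wide? x = Fin.any? λ c → (Z ! c Bool.≟ false) ×-dec (k ≤? length (residues (contract x) c))

      decompose : ∀ x h c → contract x ≡ h → x ! c ≡ x ! c % s + h ! c * s
      decompose x _ c refl rewrite contract-! x c = m≡m%n+[m/n]*n (x ! c) s

      expand : Point → Fin t → ℕ → ℕ
      expand h c r = r + h ! c * s

      contracts-to? : ∀ x h → Dec (contract x ≡ h)
      contracts-to? x h = vec-≟ (contract x) h

      narrow = filter (λ x → ¬? (wide? x)) A
      wide   = filter wide? A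

      narrow-fibre : ∀ h → length (filter (λ x → contracts-to? x h) narrow) ≤ k ^ t
      narrow-fibre h with filter (λ x → contracts-to? x h) narrow in eq
      -- Only a member `x₀` of the fibre testifies that the cell `h` is not wide, so the empty fibre
      -- is split off.
      ... | [] = z≤n
      ... | x₀ ∷ xs = subst (λ F → length F ≤ k ^ t) eq
        (≤-trans (length-mono-⊆ (Unique.filter⁺ _ (Unique.filter⁺ _ uA)) sub) (length-box W k W≤))
        where
        F = filter (λ x → contracts-to? x h) narrow
        W : Fin t → List ℕ
        W c = map (expand h c) (residues h c)
        F⁻ : ∀ {x} → x ∈ F → x ∈ A × ¬ (∃ λ c → Wide (contract x) c) × contract x ≡ h
        F⁻ x∈ with ∈-filter⁻ (λ x → contracts-to? x h) {xs = narrow} x∈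
        ... | x∈n , eq with ∈-filter⁻ (λ x → ¬? (wide? x)) {xs = A} x∈n
        ...   | x∈A , ¬w = x∈A , ¬w , eq
        sub : ∀ {x} → x ∈ F → x ∈ box W
        sub {x} x∈ with F⁻ x∈
        ... | x∈A , _ , refl = ∈-box W x λ c →
          subst (_∈ W c) (sym (decompose x h c refl)) (∈-map⁺ (expand h c) (residues⁺ x∈A c))
        not-wide : ¬ (∃ λ c → Wide h c)
        not-wide w with F⁻ (subst (x₀ ∈_) (sym eq) (here refl))
        ... | _ , ¬w , refl = ¬w w
        W≤ : ∀ c → length (W c) ≤ k
        W≤ c rewrite length-map (expand h c) (residues h c) with k ≤? length (residues h c)
        ... | no ≰   = <⇒≤ (≰⇒> ≰)
        ... | yes k≤ with Z ! c in Zc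
        ...   | false = contradiction (c , Zc , k≤) not-wide
        ...   | true  = ≤-trans (length≤1 (Sorted⇒Unique (residues-sorted h c)) same) (s≤s z≤n)
          where
          same : ∀ {v w} → v ∈ residues h c → w ∈ residues h c → v ≡ w
          same v∈ w∈ with residues⁻ h c v∈ | residues⁻ h c w∈
          ... | x , x∈ , _ , refl | y , y∈ , _ , refl = cong (_% s) (con x∈ y∈ c Zc)

      length-narrow : length narrow ≤ k ^ t * length H
      length-narrow = length≤fibres contracts-to? (k ^ t) narrow H
        (λ x∈ → H⁺ (proj₁ (∈-filter⁻ (λ x → ¬? (wide? x)) {xs = A} x∈)))
        (λ {h} _ → narrow-fibre h)

      -- A wide cell is classified by a direction c, its coordinate u there and k residues X occurring in that direction.
      Key = Fin t × ℕ × Vec ℕ k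

      Matches : Point → Key → Set
      Matches h (c , u , X) = Z ! c ≡ false × h ! c ≡ u ×
        (∀ i i′ → i Fin.< i′ → Vec.lookup X i < Vec.lookup X i′) × (∀ i → Vec.lookup X i ∈ residues h c)

      matches? : ∀ h κ → Dec (Matches h κ)
      matches? h (c , u , X) = (Z ! c Bool.≟ false) ×-dec (h ! c ≟ u) ×-dec
        Fin.all? (λ i → Fin.all? λ i′ → (i Fin.<? i′) →-dec (Vec.lookup X i <? Vec.lookup X i′)) ×-dec
        Fin.all? (λ i → Vec.lookup X i ∈? residues h c)

      keys : List Key
      keys = cartesianProduct (allFin t) (cartesianProduct (upTo K) (vectors (upTo s) k))

      length-keys : length keys ≤ t * (K * s ^ k)
      length-keys = begin
        length keys ≡⟨ length-cartesianProductWith _,_ (allFin t) _ ⟩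
        length (allFin t) * length (cartesianProduct (upTo K) (vectors (upTo s) k))
          ≡⟨ cong₂ _*_ (length-tabulate {n = t} id) (length-cartesianProductWith _,_ (upTo K) _) ⟩
        t * (length (upTo K) * length (vectors (upTo s) k))
          ≤⟨ *-monoʳ-≤ t (*-mono-≤ (≤-reflexive (length-upTo K)) (length-vectors (upTo s) k)) ⟩
        t * (K * length (upTo s) ^ k) ≡⟨ cong (λ n → t * (K * n ^ k)) (length-upTo s) ⟩
        t * (K * s ^ k) ∎
        where open ≤-Reasoning

      wide-key : ∀ {x} → x ∈ wide → Any (Matches (contract x)) keys
      wide-key {x} x∈ with ∈-filter⁻ wide? {xs = A} x∈
      ... | x∈A , c , Zc , k≤ = lose
        (∈-cartesianProduct⁺ (∈-allFin c)
          (∈-cartesianProduct⁺ (∈-upTo⁺ (box-H (H⁺ x∈A) c)) (∈-box (λ _ → upTo s) X X∈)))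
        (Zc , refl , (λ i i′ lt → subst₂ _<_ (sym (X! i)) (sym (X! i′))
          (pick-mono V k≤ (residues-sorted (contract x) c) lt)) ,
          (λ i → subst (_∈ V) (sym (X! i)) (pick-∈ V k≤ i)))
        where
        V = residues (contract x) c
        X = Vec.tabulate (pick V k≤)
        X! : ∀ i → Vec.lookup X i ≡ pick V k≤ i
        X! i = Vec.lookup∘tabulate (pick V k≤) i
        X∈ : ∀ i → Vec.lookup X i ∈ upTo s
        X∈ i = proj₁ (∈-filter⁻ (λ r → any? (residue? (contract x) c r) A) {xs = upTo s}
          (subst (_∈ V) (sym (X! i)) (pick-∈ V k≤ i)))

      -- All cells with key `(c , u , X)` agree in coordinate `c`, so `c` can join `Z`. Given an
      -- occurrence among them for `Z′`, replace its point `i` by a preimage whose residue in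
      -- direction `c` is the entry of `X` at `rk S c i`. Since `u` and `X` are common to all these
      -- cells, the order in direction `c` becomes the prescribed one, and the strict inequalities
      -- in the other directions survive. So these cells avoid with one free coordinate less, and
      -- `ih` applies.
      length-matching : ∀ κ → length (filter (λ h → matches? h κ) H) ≤ C * K ^ D′
      length-matching κ@(c , u , X) with filter (λ h → matches? h κ) H in eq
      ... | [] = z≤n
      ... | h₀ ∷ hs = subst (λ W → length W ≤ C * K ^ D′) eq
          (ih e Z′ W (Unique.filter⁺ _ uH) (λ h∈ → box-H (W⊆H h∈)) con-W av-W)
        where
        W = filter (λ h → matches? h κ) H
        Z′ = Z Vec.[ c ]≔ true
        W⊆H : ∀ {h} → h ∈ W → h ∈ H
        W⊆H h∈ = proj₁ (∈-filter⁻ (λ h → matches? h κ) {xs = H} h∈)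
        W-key : ∀ {h} → h ∈ W → Matches h κ
        W-key h∈ = proj₂ (∈-filter⁻ (λ h → matches? h κ) {xs = H} h∈)
        h₀-key : Matches h₀ κ
        h₀-key = W-key (subst (h₀ ∈_) (sym eq) (here refl))
        Zc = proj₁ h₀-key
        X-mono = proj₁ (proj₂ (proj₂ h₀-key))
        con-W : Constant Z′ W
        con-W h∈ h′∈ j Z′j with j Fin.≟ c
        ... | yes refl = trans (proj₁ (proj₂ (W-key h∈))) (sym (proj₁ (proj₂ (W-key h′∈))))
        ... | no j≢c   = con-H (W⊆H h∈) (W⊆H h′∈) j (trans (sym (insert-unchanged {Z} j≢c)) Z′j)
        av-W : Avoids Z′ (suc D′) W
        av-W S Z′⊑S cnt (y , y∈ , ord) = av S (λ j Zj → Z′⊑S j (insert-⊒ Z c j Zj))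
          (trans cnt (trans (cong (_+ suc D′) (countTrue-insert Z c Zc)) (sym (+-suc (countTrue Z) (suc D′)))))
          (x , (λ i → proj₁ (proj₂ (witness i))) , order)
          where
          r : I → ℕ
          r i = Vec.lookup X (rk S c i)
          witness : ∀ i → ∃ λ x → x ∈ A × Residue (y i) c (r i) x
          witness i = residues⁻ (y i) c (proj₂ (proj₂ (proj₂ (W-key (y∈ i)))) (rk S c i))
          x : I → Point
          x i = proj₁ (witness i)
          x-c : ∀ i → x i ! c ≡ r i + u * s
          x-c i = trans (decompose (x i) (y i) c (proj₁ (proj₂ (proj₂ (witness i)))))
            (cong₂ (λ a b → a + b * s) (proj₂ (proj₂ (proj₂ (witness i)))) (proj₁ (proj₂ (W-key (y∈ i)))))
          order : ∀ j → Z ! j ≡ false → S ! j ≡ true → ∀ i i′ → rk S j i Fin.< rk S j i′ → x i ! j < x i′ ! j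
          order j Zj Sj i i′ lt with j Fin.≟ c
          ... | yes refl = subst₂ _<_ (sym (x-c i)) (sym (x-c i′)) (+-monoˡ-< (u * s) (X-mono _ _ lt))
          ... | no j≢c   = contract-reflects-< (x i) (x i′) j
            (subst₂ (λ a b → a ! j < b ! j) (sym (proj₁ (proj₂ (proj₂ (witness i)))))
              (sym (proj₁ (proj₂ (proj₂ (witness i′)))))
              (ord j (trans (insert-unchanged {Z} j≢c) Zj) Sj i i′ lt))

      block-fibre : ∀ B h → Unique B → length (filter (λ x → contracts-to? x h) B) ≤ s ^ t
      block-fibre B h uB = ≤-trans (length-mono-⊆ (Unique.filter⁺ _ uB) sub) (length-box W s W≤)
        where
        W : Fin t → List ℕ
        W c = map (expand h c) (upTo s)
        W≤ : ∀ c → length (W c) ≤ s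
        W≤ c = ≤-reflexive (trans (length-map (expand h c) (upTo s)) (length-upTo s))
        sub : ∀ {x} → x ∈ filter (λ x → contracts-to? x h) B → x ∈ box W
        sub {x} x∈ = ∈-box W x λ c → subst (_∈ W c)
          (sym (decompose x h c (proj₂ (∈-filter⁻ (λ x → contracts-to? x h) {xs = B} x∈))))
          (∈-map⁺ (expand h c) (∈-upTo⁺ (m%n<n (x ! c) s)))

      wide-fibre : ∀ κ → length (filter (λ x → matches? (contract x) κ) wide) ≤ s ^ t * (C * K ^ D′)
      wide-fibre κ = ≤-trans
        (length≤fibres contracts-to? (s ^ t) G (filter (λ h → matches? h κ) H) cover
          (λ {h} _ → block-fibre G h (Unique.filter⁺ _ (Unique.filter⁺ _ uA))))
        (*-monoʳ-≤ (s ^ t) (length-matching κ))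
        where
        G = filter (λ x → matches? (contract x) κ) wide
        cover : ∀ {x} → x ∈ G → contract x ∈ filter (λ h → matches? h κ) H
        cover x∈ with ∈-filter⁻ (λ x → matches? (contract x) κ) {xs = wide} x∈
        ... | x∈w , m = ∈-filter⁺ (λ h → matches? h κ) (H⁺ (proj₁ (∈-filter⁻ wide? {xs = A} x∈w))) m

      length-wide : length wide ≤ s ^ t * (C * K ^ D′) * (t * (K * s ^ k))
      length-wide = ≤-trans
        (length≤fibres (λ x κ → matches? (contract x) κ) (s ^ t * (C * K ^ D′)) wide keys wide-key
          (λ {κ} _ → wide-fibre κ))
        (*-monoʳ-≤ (s ^ t * (C * K ^ D′)) length-keys)

      length-A : length A ≤ k ^ t * (C′ * K ^ suc D′) + s ^ t * (C * K ^ D′) * (t * (K * s ^ k))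
      length-A = ≤-trans
        (≤-reflexive (trans (length-split wide? A) (+-comm (length wide) _)))
        (+-mono-≤ (≤-trans length-narrow (*-monoʳ-≤ (k ^ t) length-H)) length-wide)

    step : ∀ D′ C → Bound D′ C → ∃ (Bound (suc D′))
    step D′ C ih = C′ , bound
      where
      Q = s ^ t * C * (t * s ^ k)
      -- `Q` is the contribution of the wide cells per `K ^ suc D′`. The narrow cells use the factor
      -- `k ^ t` out of `s`, and `s` is at least twice that, so `Q ≤ C′` suffices. The successor
      -- makes `C′` positive, as the box with a single cell requires.
      C′ = suc Q
      bound : Bound (suc D′) C′
      bound zero Z A uA box con av = ≤-trans (unit-box uA box)
        (≤-trans (s≤s (z≤n {Q})) (≤-reflexive (sym (trans (cong (C′ *_) (^-zeroˡ (suc D′))) (*-identityʳ C′)))))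
      bound (suc e) Z A uA box con av = begin
        length A ≤⟨ Contraction.length-A D′ C ih C′ e (bound e) Z A uA box con av ⟩
        k ^ t * (C′ * K ^ suc D′) + s ^ t * (C * K ^ D′) * (t * (K * s ^ k))
          ≡⟨ rearrange (k ^ t) C′ (K ^ D′) (s ^ t) C t K (s ^ k) ⟩
        (k ^ t * C′ + Q) * (K ^ suc D′) ≤⟨ *-monoˡ-≤ (K ^ suc D′) absorb ⟩
        -- One factor `s` is affordable because the exponent `suc D′` is positive; for exponent 0
        -- there is no such gain, hence the direct argument in `base`.
        C′ * s * K ^ suc D′ ≤⟨ *-monoˡ-≤ (K ^ suc D′)
          (*-monoʳ-≤ C′ (≤-trans (≤-reflexive (sym (*-identityʳ s))) (^-monoʳ-≤ s {1} {suc D′} (s≤s z≤n)))) ⟩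
        C′ * s ^ suc D′ * K ^ suc D′ ≡⟨ *-assoc C′ (s ^ suc D′) (K ^ suc D′) ⟩
        C′ * (s ^ suc D′ * K ^ suc D′) ≡⟨ cong (C′ *_) (^-distribʳ-* (suc D′) s K) ⟨
        C′ * (s * K) ^ suc D′ ∎
        where
        open ≤-Reasoning
        K = s ^ e
        rearrange : ∀ kt c kd st C t K sk →
          kt * (c * (K * kd)) + st * (C * kd) * (t * (K * sk)) ≡ (kt * c + st * C * (t * sk)) * (K * kd)
        rearrange = solve-∀
        absorb : k ^ t * C′ + Q ≤ C′ * s
        absorb = begin
          k ^ t * C′ + Q            ≤⟨ +-monoʳ-≤ (k ^ t * C′) (n≤1+n Q) ⟩
          k ^ t * C′ + C′           ≤⟨ +-monoʳ-≤ (k ^ t * C′) (m≤n*m C′ (k ^ t) ⦃ m^n≢0 k t ⦄) ⟩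
          k ^ t * C′ + k ^ t * C′   ≡⟨ double (k ^ t) C′ ⟩
          C′ * (k ^ t * 2)          ≤⟨ *-monoʳ-≤ C′ s-large ⟩
          C′ * s                    ∎
          where
          double : ∀ a b → a * b + a * b ≡ b * (a * 2)
          double = solve-∀

    bounds : ∀ D′ → ∃ (Bound D′)
    bounds zero     = k ^ t , base
    bounds (suc D′) = step D′ (proj₁ (bounds D′)) (proj₂ (bounds D′))

  bounded-length : ∀ D′ → ∃ λ C → ∀ K → 1 ≤ K → ∀ A → Unique A → InBox K A →
    Avoids (Vec.replicate t false) (suc D′) A → length A ≤ C * K ^ D′
  -- The factor `s ^ D′` pays for rounding the side up to the next power of `s`.
  bounded-length D′ = C * s ^ D′ , bound
    where
    s = k ^ t * 2
    instance
      s≢0 : NonZero s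
      s≢0 = m*n≢0 (k ^ t) 2 ⦃ m^n≢0 k t ⦄
    open Scaled s ≤-refl
    C = proj₁ (bounds D′)
    1<s : 1 < s
    1<s = *-mono-≤ {1} (n≢0⇒n>0 (≢-nonZero⁻¹ (k ^ t) ⦃ m^n≢0 k t ⦄)) (≤-refl {2})
    bound : ∀ K → 1 ≤ K → ∀ A → Unique A → InBox K A →
      Avoids (Vec.replicate t false) (suc D′) A → length A ≤ C * s ^ D′ * K ^ D′
    bound K 1≤K A uA box av with power-bracket s 1<s K 1≤K
    ... | e , s^e≤K , K<s^1+e = begin
      length A                  ≤⟨ proj₂ (bounds D′) (suc e) (Vec.replicate t false) A uA
                                     (λ x∈ j → <-trans (box x∈ j) K<s^1+e) none av ⟩
      C * (s * s ^ e) ^ D′      ≤⟨ *-monoʳ-≤ C (^-monoˡ-≤ D′ (*-monoʳ-≤ s s^e≤K)) ⟩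
      C * (s * K) ^ D′          ≡⟨ cong (C *_) (^-distribʳ-* D′ s K) ⟩
      C * (s ^ D′ * K ^ D′)     ≡⟨ *-assoc C (s ^ D′) (K ^ D′) ⟨
      C * s ^ D′ * K ^ D′       ∎
      where
      open ≤-Reasoning
      none : Constant (Vec.replicate t false) A
      none _ _ j eq with () ← trans (sym (Vec.lookup-replicate j false)) eq

-- The total size of an avoiding hypergraph

-- For `j` in `S`, this is the number of the layer that coordinate `j` plays.
position : ∀ {t} → Vec Bool t → Fin t → ℕ
position (_ ∷ S)     zero    = 0
position (true ∷ S)  (suc j) = suc (position S j)
position (false ∷ S) (suc j) = position S j

select : ∀ {t} (S : Vec Bool t) → Fin (countTrue S) → Fin t
select (true ∷ S)  zero    = zero
select (true ∷ S)  (suc l) = suc (select S l)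
select (false ∷ S) l       = suc (select S l)

select-∈ : ∀ {t} (S : Vec Bool t) l → Vec.lookup S (select S l) ≡ true
select-∈ (true ∷ S)  zero    = refl
select-∈ (true ∷ S)  (suc l) = select-∈ S l
select-∈ (false ∷ S) l       = select-∈ S l

position-select : ∀ {t} (S : Vec Bool t) l → position S (select S l) ≡ toℕ l
position-select (true ∷ S)  zero    = refl
position-select (true ∷ S)  (suc l) = cong suc (position-select S l)
position-select (false ∷ S) l       = position-select S l

select-mono : ∀ {t} (S : Vec Bool t) {l l′} → l Fin.< l′ → select S l Fin.< select S l′
select-mono (true ∷ S)  {zero}  {suc l′} _       = s≤s z≤n
select-mono (true ∷ S)  {suc l} {suc l′} (s≤s p) = s≤s (select-mono S p)
select-mono (false ∷ S) p = s≤s (select-mono S p)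

nth : List ℕ → ℕ → ℕ
nth []       _       = 0
nth (x ∷ xs) zero    = x
nth (x ∷ xs) (suc i) = nth xs i

nth-∈ : ∀ E {i} → i < length E → nth E i ∈ E
nth-∈ (x ∷ E) {zero}  _       = here refl
nth-∈ (x ∷ E) {suc i} (s≤s p) = there (nth-∈ E p)

nth-mono-< : ∀ {E} → Sorted E → ∀ {i j} → i < j → j < length E → nth E i < nth E j
nth-mono-< {x ∷ E} (x< ∷ _)  {zero}  {suc j} _       (s≤s q) = All.lookup x< (nth-∈ E q)
nth-mono-< {x ∷ E} (_ ∷ srt) {suc i} {suc j} (s≤s p) (s≤s q) = nth-mono-< srt p q

nth-mono-≤ : ∀ {E} → Sorted E → ∀ {i j} → i ≤ j → j < length E → nth E i ≤ nth E j
nth-mono-≤ srt i≤j j< with m≤n⇒m<n∨m≡n i≤j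
... | inj₁ i<j  = <⇒≤ (nth-mono-< srt i<j j<)
... | inj₂ refl = ≤-refl

∈-nth : ∀ {E z} → z ∈ E → ∃ λ i → i < length E × nth E i ≡ z
∈-nth (here refl) = 0 , s≤s z≤n , refl
∈-nth (there z∈) with ∈-nth z∈
... | i , i< , eq = suc i , s≤s i< , eq

Edge = List ℕ

weight : List Edge → ℕ
weight H = sum (map length H)

Unique-map : ∀ {A B : Set} (f : A → B) {xs} → (∀ {x y} → x ∈ xs → y ∈ xs → f x ≡ f y → x ≡ y) → Unique xs →
  Unique (map f xs)
Unique-map f inj [] = []
Unique-map f {x ∷ xs} inj (x∉ ∷ uxs) =
  All.map⁺ (All.tabulate λ {y} y∈ eq → All.lookup x∉ y∈ (inj (here refl) (there y∈) eq)) ∷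
  Unique-map f (λ x∈ y∈ → inj (there x∈) (there y∈)) uxs

-- Edges are increasing lists, so that edges with the same vertices are equal as lists.
record Hypergraph (K : ℕ) (H : List Edge) : Set where
  field
    sorted   : ∀ {E} → E ∈ H → Sorted E
    nonempty : ∀ {E} → E ∈ H → 1 ≤ length E
    bounded  : ∀ {E} → E ∈ H → ∀ {z} → z ∈ E → z < K

-- The edges e i are ordered like the blocks of [σ₁,…,σ_d], with x i l the element of e i in layer l.
record ContainsPattern (m d : ℕ) (σ : ℕ → Fin m → Fin m) (H : List Edge) : Set where
  field
    e        : Fin m → Edge
    e∈       : ∀ i → e i ∈ H
    distinct : ∀ {i i′} → i ≢ i′ → e i ≢ e i′
    x        : Fin m → Fin (suc d) → ℕ
    x∈       : ∀ i l → x i l ∈ e i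
    within   : ∀ l {i i′} → σ (toℕ l) i Fin.< σ (toℕ l) i′ → x i l < x i′ l
    across   : ∀ {l l′} i i′ → l Fin.< l′ → x i l < x i′ l′

module Weights (m′ d′ : ℕ) (σ : ℕ → Fin (suc m′) → Fin (suc m′)) (σ-id : ∀ i → σ 0 i ≡ i) where

  m = suc m′
  d = suc d′
  p = suc d * m

  Avoiding : List Edge → Set
  Avoiding H = ¬ ContainsPattern m d σ H

  -- The extra points inj₂ e are maximal in layer e and minimal in all the others. As points have weakly
  -- increasing coordinates, they force the layers of the remaining points to lie one after the other.
  rank : ℕ → Fin m ⊎ Fin d → Fin (suc (suc m))
  rank l (inj₁ i) = suc (Fin.inject₁ (σ l i))
  rank l (inj₂ e) with toℕ e ≟ l
  ... | yes _ = Fin.fromℕ (suc m)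
  ... | no  _ = zero

  rank-within : ∀ l {i i′} → σ l i Fin.< σ l i′ → rank l (inj₁ i) Fin.< rank l (inj₁ i′)
  rank-within l {i} {i′} lt = s≤s (subst₂ _<_ (sym (Fin.toℕ-inject₁ (σ l i))) (sym (Fin.toℕ-inject₁ (σ l i′))) lt)

  rank-top : ∀ i (e : Fin d) → rank (toℕ e) (inj₁ i) Fin.< rank (toℕ e) (inj₂ e)
  rank-top i e with toℕ e ≟ toℕ e
  ... | yes _ = s≤s (subst₂ _<_ (sym (Fin.toℕ-inject₁ (σ (toℕ e) i))) (sym (Fin.toℕ-fromℕ m))
      (Fin.toℕ<n (σ (toℕ e) i)))
  ... | no ≢  = contradiction refl ≢

  rank-bottom : ∀ l i (e : Fin d) → toℕ e ≢ l → rank l (inj₂ e) Fin.< rank l (inj₁ i)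
  rank-bottom l i e ≢ with toℕ e ≟ l
  ... | yes eq = contradiction eq ≢
  ... | no  _  = s≤s z≤n

  -- The dimension is `p`, one coordinate for each vertex of a piece. There are `suc (suc m)` ranks:
  -- one for each of the `m` offsets, and the two extremes that the extra points take.
  open MarcusTardos p (suc m) (Fin m ⊎ Fin d) (λ S j → rank (position S j))

  Separated : Point → Point → Set
  Separated v w = ∀ j j′ → v ! j < w ! j′

  -- Monotonicity is weak because padded short edges repeat their last vertex.
  record Owns (E : Edge) (v : Point) : Set where
    field
      entries    : ∀ j → v ! j ∈ E
      increasing : ∀ {j j′} → j Fin.≤ j′ → v ! j ≤ v ! j′

  Owned : List Edge → (Edge → Point → Set) → List Point → Set
  Owned H Piece A = ∀ {v} → v ∈ A → ∃ λ E → E ∈ H × Piece E v × Owns E v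

  SeparatedPieces : (Edge → Point → Set) → Set
  SeparatedPieces Piece = ∀ {E v w} → Sorted E → Piece E v → Piece E w → v ≡ w ⊎ Separated v w ⊎ Separated w v

  occurs⇒pattern : ∀ {K H A Piece} → Hypergraph K H → Owned H Piece A → SeparatedPieces Piece → ∀ {S} →
    countTrue S ≡ suc d → Occurs (Vec.replicate p false) S A → ContainsPattern m d σ H
  occurs⇒pattern {H = H} {A} {Piece} hyp own sep {S} cnt (y , y∈ , ord) = record
    { e = e
    ; e∈ = λ i → proj₁ (proj₂ (own (y∈ (inj₁ i))))
    ; distinct = distinct
    ; x = λ i l → coord (inj₁ i) l
    ; x∈ = λ i l → Owns.entries (owns (inj₁ i)) (c l)
    ; within = λ l lt → order l (rank-within (toℕ l) lt)
    ; across = λ i i′ → across i i′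
    }
    where
    e : Fin m → Edge
    e i = proj₁ (own (y∈ (inj₁ i)))
    owns : ∀ i → Owns (proj₁ (own (y∈ i))) (y i)
    owns i = proj₂ (proj₂ (proj₂ (own (y∈ i))))
    c : Fin (suc d) → Fin p
    c l = select S (Fin.cast (sym cnt) l)
    position-c : ∀ l → position S (c l) ≡ toℕ l
    position-c l = trans (position-select S (Fin.cast (sym cnt) l)) (Fin.toℕ-cast (sym cnt) l)
    c-mono : ∀ {l l′} → l Fin.< l′ → c l Fin.< c l′
    c-mono {l} {l′} lt = select-mono S
      (subst₂ _<_ (sym (Fin.toℕ-cast (sym cnt) l)) (sym (Fin.toℕ-cast (sym cnt) l′)) lt)
    coord : Fin m ⊎ Fin d → Fin (suc d) → ℕ
    coord i l = y i ! c l
    order : ∀ l {i i′} → rank (toℕ l) i Fin.< rank (toℕ l) i′ → coord i l < coord i′ l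
    order l {i} {i′} lt = ord (c l) (Vec.lookup-replicate (c l) false) (select-∈ S (Fin.cast (sym cnt) l)) i i′
      (subst (λ n → rank n i Fin.< rank n i′) (sym (position-c l)) lt)
    across : ∀ i i′ {l l′} → l Fin.< l′ → coord (inj₁ i) l < coord (inj₁ i′) l′
    across i i′ {l} {l′} lt = begin-strict
      coord (inj₁ i) l  <⟨ order l (subst (λ n → rank n (inj₁ i) Fin.< rank n (inj₂ f)) f≡l (rank-top i f)) ⟩
      coord (inj₂ f) l  ≤⟨ Owns.increasing (owns (inj₂ f)) (<⇒≤ (c-mono lt)) ⟩
      coord (inj₂ f) l′ <⟨ order l′ (rank-bottom (toℕ l′) i′ f λ eq → <⇒≢ lt (trans (sym f≡l) eq)) ⟩
      coord (inj₁ i′) l′ ∎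
      where
      open ≤-Reasoning
      l<d : toℕ l < d
      l<d = <-≤-trans lt (≤-pred (Fin.toℕ<n l′))
      f = fromℕ< l<d
      f≡l : toℕ f ≡ toℕ l
      f≡l = Fin.toℕ-fromℕ< l<d
    same-owner : ∀ {E E′ v w} → E ∈ H → E ≡ E′ → Piece E v → Piece E′ w → v ≡ w ⊎ Separated v w ⊎ Separated w v
    same-owner E∈ refl pv pw = sep (Hypergraph.sorted hyp E∈) pv pw
    -- Two pieces of one edge are equal or one lies entirely before the other. Equality contradicts
    -- layer 0, where the order is that of the indices. Precedence contradicts `across`: layer 0 of
    -- either point is below layer 1 of the other. Layer 1 exists because `d` is a successor.
    ordered-distinct : ∀ {i i′} → i Fin.< i′ → e i ≢ e i′
    ordered-distinct {i} {i′} i<i′ eq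
      with same-owner (proj₁ (proj₂ (own (y∈ (inj₁ i))))) eq
             (proj₁ (proj₂ (proj₂ (own (y∈ (inj₁ i)))))) (proj₁ (proj₂ (proj₂ (own (y∈ (inj₁ i′))))))
    ... | inj₁ v≡w        = <⇒≢
        (order zero {inj₁ i} {inj₁ i′} (rank-within 0 (subst₂ Fin._<_ (sym (σ-id i)) (sym (σ-id i′)) i<i′)))
                              (cong (λ v → v ! (c zero)) v≡w)
    ... | inj₂ (inj₁ v<w) = <-asym (v<w (c (suc zero)) (c zero)) (across i′ i {zero} {suc zero} (s≤s z≤n))
    ... | inj₂ (inj₂ w<v) = <-asym (w<v (c (suc zero)) (c zero)) (across i i′ {zero} {suc zero} (s≤s z≤n))
    distinct : ∀ {i i′} → i ≢ i′ → e i ≢ e i′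
    distinct {i} {i′} i≢i′ with Fin.<-cmp i i′
    ... | tri< lt _ _ = ordered-distinct lt
    ... | tri≈ _ eq _ = contradiction eq i≢i′
    ... | tri> _ _ gt = ordered-distinct gt ∘ sym

  C₀ = proj₁ (bounded-length d)

  -- The notion of piece is a parameter because the bound serves twice: for the full pieces of long
  -- edges, and for short edges padded to length `p`.
  length-pieces : ∀ {K H A Piece} → 1 ≤ K → Hypergraph K H → Avoiding H → Unique A →
    Owned H Piece A → SeparatedPieces Piece → length A ≤ C₀ * K ^ d
  length-pieces {K} {H} {A} {Piece} 1≤K hyp av uA own sep = proj₂ (bounded-length d) K 1≤K A uA box′
    (λ S _ cnt occ → av (occurs⇒pattern hyp own sep {S} (trans cnt (cong (_+ suc d) (none p))) occ))
    where
    none : ∀ t → countTrue (Vec.replicate t false) ≡ 0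
    none zero    = refl
    none (suc t) = none t
    box′ : InBox K A
    box′ v∈ j with own v∈
    ... | E , E∈ , _ , o = Hypergraph.bounded hyp E∈ (Owns.entries o j)

  piece : Edge → ℕ → Point
  piece E q = Vec.tabulate λ j → nth E (q * p + toℕ j)

  piece-! : ∀ E q j → piece E q ! j ≡ nth E (q * p + toℕ j)
  piece-! E q j = Vec.lookup∘tabulate (λ j → nth E (q * p + toℕ j)) j

  quotient : Edge → ℕ
  quotient E = length E / p

  index< : ∀ {E q} → q < quotient E → (j : Fin p) → q * p + toℕ j < length E
  index< {E} {q} q< j = begin-strict
    q * p + toℕ j     <⟨ +-monoʳ-< (q * p) (Fin.toℕ<n j) ⟩
    q * p + p         ≡⟨ +-comm (q * p) p ⟩
    suc q * p         ≤⟨ *-monoˡ-≤ p q< ⟩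
    quotient E * p    ≤⟨ m/n*n≤m (length E) p ⟩
    length E          ∎
    where open ≤-Reasoning

  Full : Edge → Point → Set
  Full E v = ∃ λ q → q < quotient E × v ≡ piece E q

  piece-∈ : ∀ {E q} → q < quotient E → ∀ j → piece E q ! j ∈ E
  piece-∈ {E} {q} q< j = subst (_∈ E) (sym (piece-! E q j)) (nth-∈ E (index< {E} q< j))

  full-mono : ∀ {E v} → Sorted E → Full E v → ∀ {j j′} → j Fin.< j′ → v ! j < v ! j′
  full-mono {E} srt (q , q< , refl) {j} {j′} lt rewrite piece-! E q j | piece-! E q j′ =
    nth-mono-< srt (+-monoʳ-< (q * p) lt) (index< {E} q< j′)

  full-owns : ∀ {E v} → Sorted E → Full E v → Owns E v
  full-owns {E} srt (q , q< , refl) = record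
    { entries = piece-∈ q<
    ; increasing = λ {j} {j′} j≤j′ → subst₂ _≤_ (sym (piece-! E q j)) (sym (piece-! E q j′))
        (nth-mono-≤ srt (+-monoʳ-≤ (q * p) j≤j′) (index< {E} q< j′)) }

  pieces-separated : ∀ {E q q′} → Sorted E → q < q′ → q′ < quotient E → Separated (piece E q) (piece E q′)
  pieces-separated {E} {q} {q′} srt q<q′ q′< j j′ rewrite piece-! E q j | piece-! E q′ j′ =
    nth-mono-< srt (begin-strict
      q * p + toℕ j    <⟨ +-monoʳ-< (q * p) (Fin.toℕ<n j) ⟩
      q * p + p        ≡⟨ +-comm (q * p) p ⟩
      suc q * p        ≤⟨ *-monoˡ-≤ p q<q′ ⟩
      q′ * p           ≤⟨ m≤m+n (q′ * p) (toℕ j′) ⟩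
      q′ * p + toℕ j′  ∎) (index< {E} q′< j′)
    where open ≤-Reasoning

  full-separated : SeparatedPieces Full
  full-separated srt (q , q< , refl) (q′ , q′< , refl) with <-cmp q q′
  ... | tri< lt _ _   = inj₂ (inj₁ (pieces-separated srt lt q′<))
  ... | tri≈ _ refl _ = inj₁ refl
  ... | tri> _ _ gt   = inj₂ (inj₂ (pieces-separated srt gt q<))

  -- Repeating the last vertex keeps the coordinates in the edge and weakly increasing, and an edge
  -- of at most `p` vertices can be read off from the result.
  pad : Edge → Point
  pad E = Vec.tabulate λ j → nth E (toℕ j ⊓ pred (length E))

  pad-! : ∀ E j → pad E ! j ≡ nth E (toℕ j ⊓ pred (length E))
  pad-! E j = Vec.lookup∘tabulate (λ j → nth E (toℕ j ⊓ pred (length E))) j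

  pad-index : ∀ (E : Edge) → 1 ≤ length E → ∀ n → n ⊓ pred (length E) < length E
  pad-index (_ ∷ E) _ n = s≤s (m⊓n≤n n (length E))

  Padded : Edge → Point → Set
  Padded E v = v ≡ pad E

  pad-owns : ∀ {E v} → Sorted E → 1 ≤ length E → Padded E v → Owns E v
  pad-owns {E} srt ne refl = record
    { entries = λ j → subst (_∈ E) (sym (pad-! E j)) (nth-∈ E (pad-index E ne (toℕ j)))
    ; increasing = λ {j} {j′} j≤j′ → subst₂ _≤_ (sym (pad-! E j)) (sym (pad-! E j′))
        (nth-mono-≤ srt (⊓-monoˡ-≤ (pred (length E)) j≤j′) (pad-index E ne (toℕ j′))) }

  pad-⊆ : ∀ {E E′} → length E ≤ p → 1 ≤ length E′ → pad E ≡ pad E′ → ∀ {z} → z ∈ E → z ∈ E′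
  pad-⊆ {E} {E′} E≤p ne eq z∈ with ∈-nth z∈
  ... | i , i< , refl = subst (_∈ E′) same (nth-∈ E′ (pad-index E′ ne (toℕ j)))
    where
    i<p = <-≤-trans i< E≤p
    j = fromℕ< i<p
    i≡ : toℕ j ⊓ pred (length E) ≡ i
    i≡ rewrite Fin.toℕ-fromℕ< i<p = m≤n⇒m⊓n≡m (≤-pred (<-≤-trans i< (suc-pred-≤ (length E))))
      where
      suc-pred-≤ : ∀ n → n ≤ suc (pred n)
      suc-pred-≤ zero    = z≤n
      suc-pred-≤ (suc n) = ≤-refl
    same : nth E′ (toℕ j ⊓ pred (length E′)) ≡ nth E i
    same = trans (sym (pad-! E′ j)) (trans (cong (λ v → v ! j) (sym eq)) (trans (pad-! E j) (cong (nth E) i≡)))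

  pad-injective : ∀ {E E′} → Sorted E → Sorted E′ → 1 ≤ length E → 1 ≤ length E′ → length E ≤ p → length E′ ≤ p →
    pad E ≡ pad E′ → E ≡ E′
  pad-injective srt srt′ ne ne′ E≤ E′≤ eq = Sorted-ext srt srt′ (pad-⊆ E≤ ne′ eq) (pad-⊆ E′≤ ne (sym eq))

  module _ {K : ℕ} {H : List Edge} (1≤K : 1 ≤ K) (uH : Unique H) (hyp : Hypergraph K H) (av : Avoiding H) where

    open Hypergraph hyp

    small? : ∀ (E : Edge) → Dec (length E ≤ p)
    small? E = length E ≤? p

    smalls bigs : List Edge
    smalls = filter small? H
    bigs = filter (λ E → ¬? (small? E)) H

    smalls⁻ : ∀ {E} → E ∈ smalls → E ∈ H × length E ≤ p
    smalls⁻ {E} = ∈-filter⁻ small? {xs = H}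

    bigs⁻ : ∀ {E} → E ∈ bigs → E ∈ H × ¬ length E ≤ p
    bigs⁻ {E} = ∈-filter⁻ (λ E → ¬? (small? E)) {xs = H}

    length-smalls : length smalls ≤ C₀ * K ^ d
    length-smalls = ≤-trans (≤-reflexive (sym (length-map pad smalls)))
      (length-pieces {Piece = Padded} 1≤K hyp av
        (Unique-map pad (λ E∈ E′∈ → pad-injective (sorted (proj₁ (smalls⁻ E∈))) (sorted (proj₁ (smalls⁻ E′∈)))
          (nonempty (proj₁ (smalls⁻ E∈))) (nonempty (proj₁ (smalls⁻ E′∈))) (proj₂ (smalls⁻ E∈))
            (proj₂ (smalls⁻ E′∈)))
          (Unique.filter⁺ small? uH))
        own (λ _ eq eq′ → inj₁ (trans eq (sym eq′))))
      where
      own : Owned H Padded (map pad smalls)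
      own v∈ with ∈-map⁻ pad {xs = smalls} v∈
      ... | E , E∈ , refl with smalls⁻ E∈
      ...   | E∈H , _ = E , E∈H , refl , pad-owns (sorted E∈H) (nonempty E∈H) refl

    piecesOf : Edge → List (Edge × Point)
    piecesOf E = map (λ q → E , piece E q) (upTo (quotient E))

    -- A piece may belong to several edges, so pieces are paired with their edges. `points` forgets
    -- the edge, and `multiplicity` bounds what is lost.
    incidences : List (Edge × Point)
    incidences = concatMap piecesOf bigs

    piecesOf⁻ : ∀ {E κ} → κ ∈ piecesOf E → proj₁ κ ≡ E × Full E (proj₂ κ)
    piecesOf⁻ {E} κ∈ with ∈-map⁻ (λ q → E , piece E q) κ∈
    ... | q , q∈ , refl = refl , q , ∈-upTo⁻ q∈ , refl

    incidences⁻ : ∀ {κ} → κ ∈ incidences → proj₁ κ ∈ H × Full (proj₁ κ) (proj₂ κ)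
    incidences⁻ κ∈ with find (∈-concatMap⁻ piecesOf {xs = bigs} κ∈)
    ... | E , E∈ , κ∈E with piecesOf⁻ {E} κ∈E
    ...   | refl , f = proj₁ (bigs⁻ E∈) , f

    incidences-unique : Unique incidences
    incidences-unique = Unique.concat⁺ (All.map⁺ (All.tabulate uniqueOf))
      (AllPairs.map⁺ (AllPairs.map disjoint (Unique.filter⁺ (λ E → ¬? (small? E)) uH)))
      where
      disjoint : ∀ {E E′} → E ≢ E′ → ∀ {κ} → ¬ (κ ∈ piecesOf E × κ ∈ piecesOf E′)
      disjoint {E} {E′} E≢E′ (κ∈ , κ∈′) =
        E≢E′ (trans (sym (proj₁ (piecesOf⁻ {E} κ∈))) (proj₁ (piecesOf⁻ {E′} κ∈′)))
      uniqueOf : ∀ {E} → E ∈ bigs → Unique (piecesOf E)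
      uniqueOf {E} E∈ = Unique-map (λ q → E , piece E q) inj (Unique.upTo⁺ (quotient E))
        where
        srt = sorted (proj₁ (bigs⁻ E∈))
        inj : ∀ {q q′} → q ∈ upTo (quotient E) → q′ ∈ upTo (quotient E) → (E , piece E q) ≡ (E , piece E q′) →
          q ≡ q′
        inj {q} {q′} q∈ q′∈ eq with <-cmp q q′
        ... | tri< lt _ _ = contradiction (cong (λ κ → proj₂ κ ! zero) eq)
            (<⇒≢ (pieces-separated srt lt (∈-upTo⁻ q′∈) zero zero))
        ... | tri≈ _ q≡q′ _ = q≡q′
        ... | tri> _ _ gt = contradiction (cong (λ κ → proj₂ κ ! zero) (sym eq))
            (<⇒≢ (pieces-separated srt gt (∈-upTo⁻ q∈) zero zero))

    points : List Point
    points = deduplicate vec-≟ (map proj₂ incidences)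

    length-points : length points ≤ C₀ * K ^ d
    length-points = length-pieces {Piece = Full} 1≤K hyp av
      (DecUnique.deduplicate-! vec-≟ (map proj₂ incidences)) own full-separated
      where
      own : Owned H Full points
      own v∈ with ∈-map⁻ proj₂ (∈-deduplicate⁻ vec-≟ (map proj₂ incidences) v∈)
      ... | (E , v) , κ∈ , refl with incidences⁻ κ∈
      ...   | E∈H , f = E , E∈H , f , full-owns (sorted E∈H) f

    at? : ∀ (κ : Edge × Point) v → Dec (proj₂ κ ≡ v)
    at? κ v = vec-≟ (proj₂ κ) v

    -- A full piece has (d + 1) m elements, enough to host the whole pattern; hence it lies in fewer than m edges.
    multiplicity : ∀ v → length (filter (λ κ → at? κ v) incidences) ≤ m
    multiplicity v with m ≤? length (filter (λ κ → at? κ v) incidences)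
    ... | no ≰   = <⇒≤ (≰⇒> ≰)
    ... | yes m≤ = contradiction contained av
      where
      F = filter (λ κ → at? κ v) incidences
      κ : Fin m → Edge × Point
      κ i = lookup F (Fin.inject≤ i m≤)
      κ⁻ : ∀ i → κ i ∈ incidences × proj₂ (κ i) ≡ v
      κ⁻ i = ∈-filter⁻ (λ κ → at? κ v) {xs = incidences} (∈-lookup {xs = F} (Fin.inject≤ i m≤))
      κ-injective : ∀ {i i′} → κ i ≡ κ i′ → i ≡ i′
      κ-injective {i} {i′} eq = Fin.inject≤-injective m≤ m≤ i i′
        (lookup-injective (Unique.filter⁺ (λ κ → at? κ v) incidences-unique) (Fin.inject≤ i m≤)
          (Fin.inject≤ i′ m≤) eq)
      full : ∀ i → Full (proj₁ (κ i)) v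
      full i = subst (Full (proj₁ (κ i))) (proj₂ (κ⁻ i)) (proj₂ (incidences⁻ (proj₁ (κ⁻ i))))
      mono : ∀ {j j′} → j Fin.< j′ → v ! j < v ! j′
      mono = full-mono (sorted (proj₁ (incidences⁻ (proj₁ (κ⁻ zero))))) (full zero)
      contained : ContainsPattern m d σ H
      contained = record
        { e = λ i → proj₁ (κ i)
        ; e∈ = λ i → proj₁ (incidences⁻ (proj₁ (κ⁻ i)))
        ; distinct = λ {i} {i′} i≢i′ eq →
            i≢i′ (κ-injective (cong₂ _,_ eq (trans (proj₂ (κ⁻ i)) (sym (proj₂ (κ⁻ i′))))))
        ; x = λ i l → v ! Fin.combine l (σ (toℕ l) i)
        ; x∈ = λ i l → Owns.entries (full-owns (sorted (proj₁ (incidences⁻ (proj₁ (κ⁻ i))))) (full i)) _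
        ; within = λ l {i} {i′} lt → mono (combine-monoʳ-< l lt)
        ; across = λ {l} {l′} i i′ lt → mono (Fin.combine-monoˡ-< (σ (toℕ l) i) (σ (toℕ l′) i′) lt)
        }
        where
        combine-monoʳ-< : ∀ (l : Fin (suc d)) {r r′ : Fin m} → r Fin.< r′ → Fin.combine l r Fin.< Fin.combine l r′
        combine-monoʳ-< l {r} {r′} lt = subst₂ _<_ (sym (Fin.toℕ-combine l r)) (sym (Fin.toℕ-combine l r′))
          (+-monoʳ-< (m * toℕ l) lt)

    length-incidences : length incidences ≤ m * (C₀ * K ^ d)
    length-incidences = ≤-trans
      (length≤fibres at? m incidences points
        (λ κ∈ → ∈-deduplicate⁺ vec-≟ (∈-map⁺ proj₂ κ∈)) (λ {v} _ → multiplicity v))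
      (*-monoʳ-≤ m length-points)

    weight-smalls : ∀ H′ → (∀ {E} → E ∈ H′ → length E ≤ p) → weight H′ ≤ p * length H′
    weight-smalls [] _ = z≤n
    weight-smalls (E ∷ H′) ≤p = ≤-trans (+-mono-≤ (≤p (here refl)) (weight-smalls H′ (≤p ∘ there)))
      (≤-reflexive (sym (*-suc p (length H′))))

    -- Fewer than `p` vertices follow the last full piece, and a long edge has at least one full
    -- piece. So the pieces cover at least half of it, whence the factor 2.
    weight-bigs : ∀ H′ → (∀ {E} → E ∈ H′ → ¬ length E ≤ p) → weight H′ ≤ 2 * p * length (concatMap piecesOf H′)
    weight-bigs [] _ = z≤n
    weight-bigs (E ∷ H′) ≰p = begin
      length E + weight H′ ≤⟨ +-mono-≤ head (weight-bigs H′ (≰p ∘ there)) ⟩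
      2 * p * length (piecesOf E) + 2 * p * length (concatMap piecesOf H′)
        ≡⟨ *-distribˡ-+ (2 * p) (length (piecesOf E)) _ ⟨
      2 * p * (length (piecesOf E) + length (concatMap piecesOf H′)) ≡⟨ cong (2 * p *_) (length-++ (piecesOf E)) ⟨
      2 * p * length (concatMap piecesOf (E ∷ H′)) ∎
      where
      open ≤-Reasoning
      q = quotient E
      1≤q : 1 ≤ q
      1≤q = m≥n⇒m/n>0 (<⇒≤ (≰⇒> (≰p (here refl))))
      double : ∀ p q → p * q + q * p ≡ 2 * p * q
      double = solve-∀
      head : length E ≤ 2 * p * length (piecesOf E)
      head = begin
        length E                          ≡⟨ m≡m%n+[m/n]*n (length E) p ⟩
        length E % p + q * p              ≤⟨ +-monoˡ-≤ (q * p) (<⇒≤ (m%n<n (length E) p)) ⟩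
        p + q * p                         ≤⟨ +-monoˡ-≤ (q * p)
          (≤-trans (≤-reflexive (sym (*-identityʳ p))) (*-monoʳ-≤ p 1≤q)) ⟩
        p * q + q * p                     ≡⟨ double p q ⟩
        2 * p * q                         ≡⟨ cong (2 * p *_) (trans (length-map _ (upTo q)) (length-upTo q)) ⟨
        2 * p * length (piecesOf E)       ∎

    weight-split : ∀ {P : Edge → Set} (P? : ∀ E → Dec (P E)) H′ → weight H′ ≡
      weight (filter P? H′) + weight (filter (λ E → ¬? (P? E)) H′)
    weight-split P? [] = refl
    weight-split P? (E ∷ H′) with P? E
    ... | yes _ = trans (cong (length E +_) (weight-split P? H′)) (sym (+-assoc (length E) _ _))
    ... | no  _ = trans (cong (length E +_) (weight-split P? H′)) (swap (length E) (weight (filter P? H′)) _)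
      where
      swap : ∀ a b c → a + (b + c) ≡ b + (a + c)
      swap = solve-∀

    weight-bound : weight H ≤ (p * C₀ + 2 * p * (m * C₀)) * K ^ d
    weight-bound = begin
      weight H ≡⟨ weight-split small? H ⟩
      weight smalls + weight bigs ≤⟨ +-mono-≤
        (≤-trans (weight-smalls smalls (λ E∈ → proj₂ (smalls⁻ E∈))) (*-monoʳ-≤ p length-smalls))
        (≤-trans (weight-bigs bigs (λ E∈ → proj₂ (bigs⁻ E∈))) (*-monoʳ-≤ (2 * p) length-incidences)) ⟩
      p * (C₀ * K ^ d) + 2 * p * (m * (C₀ * K ^ d)) ≡⟨ collect p C₀ (K ^ d) m ⟩
      (p * C₀ + 2 * p * (m * C₀)) * K ^ d ∎
      where
      open ≤-Reasoning
      collect : ∀ p c k m → p * (c * k) + 2 * p * (m * (c * k)) ≡ (p * c + 2 * p * (m * c)) * k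
      collect = solve-∀

-- Encoding hypergraphs by successive halving

Unique-resp-↭ : ∀ {A : Set} {xs ys : List A} → xs ↭ ys → Unique xs → Unique ys
Unique-resp-↭ _↭_.refl u = u
Unique-resp-↭ (_↭_.prep x p) (x∉ ∷ u) = ↭.All-resp-↭ p x∉ ∷ Unique-resp-↭ p u
Unique-resp-↭ (_↭_.swap x y p) ((x≢y ∷ x∉) ∷ y∉ ∷ u) =
  (≢-sym x≢y ∷ ↭.All-resp-↭ p y∉) ∷ ↭.All-resp-↭ p x∉ ∷ Unique-resp-↭ p u
Unique-resp-↭ (_↭_.trans p q) u = Unique-resp-↭ q (Unique-resp-↭ p u)

filter-cong-∈ : ∀ {A : Set} {P Q : A → Set} (P? : Decidable P) (Q? : Decidable Q) xs →
  (∀ {x} → x ∈ xs → P x → Q x) → (∀ {x} → x ∈ xs → Q x → P x) → filter P? xs ≡ filter Q? xs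
filter-cong-∈ P? Q? [] _ _ = refl
filter-cong-∈ P? Q? (x ∷ xs) f g with P? x | Q? x
... | yes _ | yes _ = cong (x ∷_) (filter-cong-∈ P? Q? xs (f ∘ there) (g ∘ there))
... | no  _ | no  _ = filter-cong-∈ P? Q? xs (f ∘ there) (g ∘ there)
... | yes p | no ¬q = contradiction (f (here refl) p) ¬q
... | no ¬p | yes q = contradiction (g (here refl) q) ¬p

filter-filter : ∀ {A : Set} {P Q : A → Set} (P? : Decidable P) (Q? : Decidable Q) xs →
  (∀ {x} → P x → Q x) → filter P? (filter Q? xs) ≡ filter P? xs
filter-filter P? Q? [] _ = refl
filter-filter P? Q? (x ∷ xs) f with Q? x
... | yes _ with P? x
...   | yes _ = cong (x ∷_) (filter-filter P? Q? xs f)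
...   | no  _ = filter-filter P? Q? xs f
filter-filter P? Q? (x ∷ xs) f | no ¬q with P? x
...   | yes p = contradiction (f p) ¬q
...   | no  _ = filter-filter P? Q? xs f

filter-split-↭ : ∀ {A : Set} {P : A → Set} (P? : Decidable P) xs → filter P? xs ++ filter (¬? ∘ P?) xs ↭ xs
filter-split-↭ P? [] = ↭-refl
filter-split-↭ P? (x ∷ xs) with P? x
... | yes _ = prep x (filter-split-↭ P? xs)
... | no  _ = ↭-trans (↭.shift x (filter P? xs) _) (prep x (filter-split-↭ P? xs))

concatMap-cong-∈ : ∀ {A B : Set} {f g : A → List B} xs → (∀ {x} → x ∈ xs → f x ≡ g x) →
  concatMap f xs ≡ concatMap g xs
concatMap-cong-∈ [] _ = refl
concatMap-cong-∈ (x ∷ xs) eq = cong₂ _++_ (eq (here refl)) (concatMap-cong-∈ xs (eq ∘ there))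

-- Decoding emits the edges parent by parent, so a hypergraph is recovered only up to reordering;
-- `group` gives the order in which its edges come out.
module Grouping {A B : Set} (f : A → B) (_≟ᴮ_ : DecidableEquality B) where

  fibre : List A → B → List A
  fibre xs y = filter (λ x → f x ≟ᴮ y) xs

  group : List A → List B → List A
  group xs = concatMap (fibre xs)

  group-↭ : ∀ xs {ys} → Unique ys → (∀ {x} → x ∈ xs → f x ∈ ys) → group xs ys ↭ xs
  group-↭ [] {ys} _ _ = subst (_↭ []) (sym (empty ys)) ↭-refl
    where
    empty : ∀ ys → group [] ys ≡ []
    empty []       = refl
    empty (_ ∷ ys) = empty ys
  group-↭ (x ∷ xs) [] cover with () ← cover (here refl)
  group-↭ xs@(_ ∷ _) {y ∷ ys} (y∉ ∷ uys) cover =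
    ↭-trans (↭.++⁺ˡ (fibre xs y) (subst (_↭ rest) (concatMap-cong-∈ ys same) (group-↭ rest uys cover′)))
            (filter-split-↭ (λ x → f x ≟ᴮ y) xs)
    where
    rest = filter (λ x → ¬? (f x ≟ᴮ y)) xs
    same : ∀ {z} → z ∈ ys → fibre rest z ≡ fibre xs z
    same {z} z∈ = filter-filter (λ x → f x ≟ᴮ z) (λ x → ¬? (f x ≟ᴮ y)) xs
      (λ fx≡z fx≡y → All.lookup y∉ z∈ (trans (sym fx≡y) fx≡z))
    cover′ : ∀ {x} → x ∈ rest → f x ∈ ys
    cover′ {x} x∈ with ∈-filter⁻ (λ x → ¬? (f x ≟ᴮ y)) {xs = xs} x∈
    ... | x∈xs , ≢y with cover x∈xs
    ...   | here ≡y = contradiction ≡y ≢y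
    ...   | there p = p

  map-group : ∀ xs ys → map f (group xs ys) ≡ concatMap (λ y → replicate (length (fibre xs y)) y) ys
  map-group xs [] = refl
  map-group xs (y ∷ ys) = trans (map-++ f (fibre xs y) (group xs ys)) (cong₂ _++_
    (constant (fibre xs y) (λ x∈ → proj₂ (∈-filter⁻ (λ x → f x ≟ᴮ y) {xs = xs} x∈))) (map-group xs ys))
    where
    constant : ∀ zs → (∀ {z} → z ∈ zs → f z ≡ y) → map f zs ≡ replicate (length zs) y
    constant [] _ = refl
    constant (z ∷ zs) eq = cong₂ _∷_ (eq (here refl)) (constant zs (eq ∘ there))

repeatBy : ∀ {A : Set} → List A → List Bool → List A
repeatBy []       _            = []
repeatBy (_ ∷ _)  []           = []
repeatBy (x ∷ xs) (false ∷ bs) = repeatBy xs bs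
repeatBy (x ∷ xs) (true ∷ bs)  = x ∷ repeatBy (x ∷ xs) bs

-- Multiplicities in unary: `true` asks for one more copy of the current element, `false` passes to
-- the next element. The length is linear in the copies and the elements, without a logarithm.
unary : ∀ {A : Set} → (A → ℕ) → List A → List Bool
unary t = concatMap (λ x → replicate (t x) true ++ [ false ])

repeatBy-unary : ∀ {A : Set} (t : A → ℕ) xs rest →
  repeatBy xs (unary t xs ++ rest) ≡ concatMap (λ x → replicate (t x) x) xs
repeatBy-unary t [] rest = refl
repeatBy-unary t (x ∷ xs) rest = go (t x)
  where
  go : ∀ n → repeatBy (x ∷ xs) (((replicate n true ++ [ false ]) ++ unary t xs) ++ rest) ≡
             replicate n x ++ concatMap (λ x → replicate (t x) x) xs
  go zero    = repeatBy-unary t xs rest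
  go (suc n) = cong (x ∷_) (go n)

length-unary : ∀ {A : Set} (t : A → ℕ) xs →
  length (unary t xs) ≡ length (concatMap (λ x → replicate (t x) x) xs) + length xs
length-unary t [] = refl
length-unary t (x ∷ xs) = begin
  length ((replicate (t x) true ++ [ false ]) ++ unary t xs) ≡⟨ length-++ (replicate (t x) true ++ [ false ]) ⟩
  length (replicate (t x) true ++ [ false ]) + length (unary t xs)
    ≡⟨ cong₂ _+_ (trans (length-++ (replicate (t x) true)) (cong (_+ 1) (length-replicate (t x))))
      (length-unary t xs) ⟩
  t x + 1 + (length rs + length xs) ≡⟨ move (t x) (length rs) (length xs) ⟩
  t x + length rs + suc (length xs) ≡⟨ cong (λ n → n + length rs + suc (length xs)) (length-replicate (t x)) ⟨
  length (replicate (t x) x) + length rs + suc (length xs) ≡⟨ cong (_+ suc (length xs))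
    (length-++ (replicate (t x) x)) ⟨
  length (replicate (t x) x ++ rs) + suc (length xs) ∎
  where
  open ≡-Reasoning
  rs = concatMap (λ x → replicate (t x) x) xs
  move : ∀ a b c → a + 1 + (b + c) ≡ a + b + suc c
  move = solve-∀

-- Codes vary in length, while the enumerated ones have length exactly `L`. The decoders stop by
-- themselves when their first argument is exhausted, so padding is harmless.
vector-extends : ∀ {A : Set} {alphabet : List A} {a} → a ∈ alphabet → ∀ L xs → All (_∈ alphabet) xs →
  length xs ≤ L →
  ∃ λ v → v ∈ vectors alphabet L × ∃ λ rest → Vec.toList v ≡ xs ++ rest
vector-extends a∈ zero [] [] _ = [] , here refl , [] , refl
vector-extends a∈ (suc L) [] [] _ with vector-extends a∈ L [] [] z≤n
... | v , v∈ , rest , eq = _ ∷ v , ∈-cartesianProductWith⁺ _∷_ a∈ v∈ , _ , refl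
vector-extends a∈ (suc L) (x ∷ xs) (x∈ ∷ xs∈) (s≤s ≤L) with vector-extends a∈ L xs xs∈ ≤L
... | v , v∈ , rest , eq = x ∷ v , ∈-cartesianProductWith⁺ _∷_ x∈ v∈ , rest , cong (x ∷_) eq

bools : List Bool
bools = false ∷ true ∷ []

∈-bools : ∀ b → b ∈ bools
∈-bools false = here refl
∈-bools true  = there (here refl)

edge-≟ : DecidableEquality Edge
edge-≟ = List.≡-dec _≟_


halve : Edge → Edge
halve E = deduplicate _≟_ (map ⌊_/2⌋ E)

∈-halve⁺ : ∀ {E z} → z ∈ E → ⌊ z /2⌋ ∈ halve E
∈-halve⁺ z∈ = ∈-deduplicate⁺ _≟_ (∈-map⁺ ⌊_/2⌋ z∈)

∈-halve⁻ : ∀ {E v} → v ∈ halve E → ∃ λ z → z ∈ E × v ≡ ⌊ z /2⌋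
∈-halve⁻ {E} v∈ = ∈-map⁻ ⌊_/2⌋ (∈-deduplicate⁻ _≟_ (map ⌊_/2⌋ E) v∈)

halve-sorted : ∀ {E} → Sorted E → Sorted (halve E)
halve-sorted {E} srt = AllPairs.map (λ (x≤y , x≢y) → ≤∧≢⇒< x≤y x≢y) (AllPairs.zip
  ( AllPairs-deduplicate _≟_ (AllPairs.map⁺ (AllPairs.map (⌊n/2⌋-mono ∘ <⇒≤) srt))
  , deduplicate-distinct _≟_ (map ⌊_/2⌋ E)))

length-deduplicate : ∀ {A : Set} (_≟ᴬ_ : DecidableEquality A) xs → length (deduplicate _≟ᴬ_ xs) ≤ length xs
length-deduplicate _≟ᴬ_ xs = length-mono-⊆ (DecUnique.deduplicate-! _≟ᴬ_ xs) (∈-deduplicate⁻ _≟ᴬ_ xs)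

length-halve : ∀ E → length (halve E) ≤ length E
length-halve E = ≤-trans (length-deduplicate _≟_ (map ⌊_/2⌋ E)) (≤-reflexive (length-map ⌊_/2⌋ E))

halve-nonempty : ∀ E → 1 ≤ length E → 1 ≤ length (halve E)
halve-nonempty (x ∷ E) _ = ∈-length (∈-halve⁺ {x ∷ E} (here refl))

⌊n/2⌋-< : ∀ {z K} → z < 2 * K → ⌊ z /2⌋ < K
⌊n/2⌋-< {z} {K} lt = ≰⇒> λ K≤ → <⇒≱ lt (begin
  2 * K                        ≤⟨ *-monoʳ-≤ 2 K≤ ⟩
  2 * ⌊ z /2⌋                  ≡⟨ cong (⌊ z /2⌋ +_) (+-identityʳ ⌊ z /2⌋) ⟩
  ⌊ z /2⌋ + ⌊ z /2⌋            ≤⟨ +-monoʳ-≤ ⌊ z /2⌋ (⌊n/2⌋≤⌈n/2⌉ z) ⟩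
  ⌊ z /2⌋ + ⌈ z /2⌉            ≡⟨ ⌊n/2⌋+⌈n/2⌉≡n z ⟩
  z                            ∎)
  where open ≤-Reasoning

⌊n/2⌋-reflects-< : ∀ {y z} → ⌊ y /2⌋ < ⌊ z /2⌋ → y < z
⌊n/2⌋-reflects-< lt = ≰⇒> λ z≤y → <⇒≱ lt (⌊n/2⌋-mono z≤y)

halve-hypergraph : ∀ {K H H′} → (∀ {E} → E ∈ H′ → ∃ λ E₀ → E₀ ∈ H × E ≡ halve E₀) →
  Hypergraph (2 * K) H → Hypergraph K H′
halve-hypergraph {K} {H} {H′} sub hyp = record { sorted = srt ; nonempty = ne ; bounded = bd }
  where
  open Hypergraph hyp
  srt : ∀ {E} → E ∈ H′ → Sorted E
  srt E∈ with sub E∈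
  ... | E₀ , E₀∈ , refl = halve-sorted (sorted E₀∈)
  ne : ∀ {E} → E ∈ H′ → 1 ≤ length E
  ne E∈ with sub E∈
  ... | E₀ , E₀∈ , refl = halve-nonempty E₀ (nonempty E₀∈)
  bd : ∀ {E} → E ∈ H′ → ∀ {z} → z ∈ E → z < K
  bd E∈ z∈ with sub E∈
  ... | E₀ , E₀∈ , refl with ∈-halve⁻ z∈
  ...   | y , y∈ , refl = ⌊n/2⌋-< (bounded E₀∈ y∈)

-- Halving is monotone, so strict inequalities between halves hold for any vertices above them, and
-- different halved edges come from different edges. Avoidance is thus inherited by the coarser
-- scales.
halve-contains : ∀ {m d σ} {H H′ : List Edge} → (∀ {E} → E ∈ H′ → ∃ λ E₀ → E₀ ∈ H × E ≡ halve E₀) →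
  ContainsPattern m d σ H′ → ContainsPattern m d σ H
halve-contains {m} {d} sub cp = record
  { e = λ i → proj₁ (sub (e∈ i))
  ; e∈ = λ i → proj₁ (proj₂ (sub (e∈ i)))
  ; distinct = λ {i} {i′} i≢i′ eq → distinct i≢i′
      (trans (proj₂ (proj₂ (sub (e∈ i)))) (trans (cong halve eq) (sym (proj₂ (proj₂ (sub (e∈ i′)))))))
  ; x = λ i l → proj₁ (lift i l)
  ; x∈ = λ i l → proj₁ (proj₂ (lift i l))
  ; within = λ l {i} {i′} lt → reflect (proj₂ (proj₂ (lift i l))) (proj₂ (proj₂ (lift i′ l))) (within l lt)
  ; across = λ {l} {l′} i i′ lt → reflect (proj₂ (proj₂ (lift i l))) (proj₂ (proj₂ (lift i′ l′))) (across i i′ lt)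
  }
  where
  open ContainsPattern cp
  lift : ∀ i l → ∃ λ z → z ∈ proj₁ (sub (e∈ i)) × x i l ≡ ⌊ z /2⌋
  lift i l = ∈-halve⁻ (subst (x i l ∈_) (proj₂ (proj₂ (sub (e∈ i)))) (x∈ i l))
  reflect : ∀ {a b y z} → a ≡ ⌊ y /2⌋ → b ≡ ⌊ z /2⌋ → a < b → y < z
  reflect refl refl = ⌊n/2⌋-reflects-<

parents : List Edge → List Edge
parents H = deduplicate edge-≟ (map halve H)

parents⁻ : ∀ {H E} → E ∈ parents H → ∃ λ E₀ → E₀ ∈ H × E ≡ halve E₀
parents⁻ {H} E∈ = ∈-map⁻ halve (∈-deduplicate⁻ edge-≟ (map halve H) E∈)

parents⁺ : ∀ {H E} → E ∈ H → halve E ∈ parents H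
parents⁺ E∈ = ∈-deduplicate⁺ edge-≟ (∈-map⁺ halve E∈)

length-parents : ∀ H → length (parents H) ≤ length H
length-parents H = ≤-trans (length-deduplicate edge-≟ (map halve H)) (≤-reflexive (length-map halve H))

-- The offsets describe which of the two halves of a cell are occupied.
offsets : List (List ℕ)
offsets = [] ∷ [ 0 ] ∷ [ 1 ] ∷ (0 ∷ 1 ∷ []) ∷ []

liftEdge : Edge → List (List ℕ) → Edge
liftEdge []       _        = []
liftEdge (_ ∷ _)  []       = []
liftEdge (c ∷ cs) (o ∷ os) = map (_+ 2 * c) o ++ liftEdge cs os

offsetsAt : Edge → ℕ → List ℕ
offsetsAt E c = filter (λ o → (o + 2 * c) ∈? E) (0 ∷ 1 ∷ [])

offsetsAt-∈ : ∀ E c → offsetsAt E c ∈ offsets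
offsetsAt-∈ E c with (0 + 2 * c) ∈? E
... | yes _ with (1 + 2 * c) ∈? E
...   | yes _ = there (there (there (here refl)))
...   | no  _ = there (here refl)
offsetsAt-∈ E c | no _ with (1 + 2 * c) ∈? E
...   | yes _ = there (there (here refl))
...   | no  _ = here refl

half-child : ∀ {o} c → o ∈ 0 ∷ 1 ∷ [] → ⌊ o + 2 * c /2⌋ ≡ c
half-child c (here refl) = trans (cong ⌊_/2⌋ (cong (c +_) (+-identityʳ c))) (sym (n≡⌊n+n/2⌋ c))
half-child c (there (here refl)) = trans (cong (λ n → ⌊ suc (c + n) /2⌋) (+-identityʳ c)) (odd c)
  where
  odd : ∀ c → ⌊ suc (c + c) /2⌋ ≡ c
  odd zero    = refl
  odd (suc c) rewrite +-suc c c = cong suc (odd c)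

is-child : ∀ z → ∃ λ o → o ∈ 0 ∷ 1 ∷ [] × z ≡ o + 2 * ⌊ z /2⌋
is-child zero          = 0 , here refl , refl
is-child (suc zero)    = 1 , there (here refl) , refl
is-child (suc (suc z)) with is-child z
... | o , o∈ , eq = o , o∈ , trans (cong (2 +_) eq) (shift o ⌊ z /2⌋)
  where
  shift : ∀ o h → 2 + (o + 2 * h) ≡ o + 2 * suc h
  shift = solve-∀

liftEdge⁻ : ∀ E cs {z} → z ∈ liftEdge cs (map (offsetsAt E) cs) → z ∈ E × ⌊ z /2⌋ ∈ cs
liftEdge⁻ E (c ∷ cs) z∈ with ∈-++⁻ (map (_+ 2 * c) (offsetsAt E c)) z∈
... | inj₂ z∈′ with liftEdge⁻ E cs z∈′
...   | z∈E , h∈ = z∈E , there h∈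
liftEdge⁻ E (c ∷ cs) z∈ | inj₁ z∈′ with ∈-map⁻ (_+ 2 * c) z∈′
...   | o , o∈ , refl with ∈-filter⁻ (λ o → (o + 2 * c) ∈? E) {xs = 0 ∷ 1 ∷ []} o∈
...     | o∈01 , z∈E = z∈E , here (half-child c o∈01)

liftEdge⁺ : ∀ E cs {z} → z ∈ E → ⌊ z /2⌋ ∈ cs → z ∈ liftEdge cs (map (offsetsAt E) cs)
liftEdge⁺ E (c ∷ cs) {z} z∈ (there h∈) = ∈-++⁺ʳ (map (_+ 2 * c) (offsetsAt E c)) (liftEdge⁺ E cs z∈ h∈)
liftEdge⁺ E (c ∷ cs) {z} z∈ (here refl) with is-child z
... | o , o∈ , eq = ∈-++⁺ˡ (subst (_∈ map (_+ 2 * c) (offsetsAt E c)) (sym eq)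
  (∈-map⁺ (_+ 2 * c) (∈-filter⁺ (λ o → (o + 2 * c) ∈? E) o∈ (subst (_∈ E) eq z∈))))

liftEdge-sorted : ∀ E {cs} → Sorted cs → Sorted (liftEdge cs (map (offsetsAt E) cs))
liftEdge-sorted E [] = []
liftEdge-sorted E {c ∷ cs} (c< ∷ srt) = AllPairs.++⁺
  (AllPairs.map⁺ {f = _+ 2 * c} (AllPairs.filter⁺ (λ o → (o + 2 * c) ∈? E) ((n<1+n (2 * c) ∷ []) ∷ [] ∷ [])))
  (liftEdge-sorted E srt)
  (All.tabulate λ y∈ → All.tabulate λ z∈ → ⌊n/2⌋-reflects-<
    (subst (_< _) (sym (low y∈)) (All.lookup c< (proj₂ (liftEdge⁻ E cs z∈)))))
  where
  low : ∀ {y} → y ∈ map (_+ 2 * c) (offsetsAt E c) → ⌊ y /2⌋ ≡ c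
  low y∈ with ∈-map⁻ (_+ 2 * c) y∈
  ... | o , o∈ , refl = half-child c (proj₁ (∈-filter⁻ (λ o → (o + 2 * c) ∈? E) {xs = 0 ∷ 1 ∷ []} o∈))

liftEdge-halve : ∀ {E} → Sorted E → liftEdge (halve E) (map (offsetsAt E) (halve E)) ≡ E
liftEdge-halve {E} srt = Sorted-ext (liftEdge-sorted E (halve-sorted srt)) srt
  (λ z∈ → proj₁ (liftEdge⁻ E (halve E) z∈)) (λ z∈ → liftEdge⁺ E (halve E) z∈ (∈-halve⁺ z∈))

-- The offsets of all edges form one stream without separators: each edge consumes as many as its
-- parent has cells.
liftAll : List Edge → List (List ℕ) → List Edge
liftAll []       os = []
liftAll (P ∷ Ps) os = liftEdge P (take (length P) os) ∷ liftAll Ps (List.drop (length P) os)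

liftCode : List Edge → List (List ℕ)
liftCode = concatMap (λ E → map (offsetsAt E) (halve E))

take-exact : ∀ {A : Set} (xs ys : List A) {n} → length xs ≡ n → take n (xs ++ ys) ≡ xs
take-exact [] ys refl = refl
take-exact (x ∷ xs) ys refl = cong (x ∷_) (take-exact xs ys refl)

drop-exact : ∀ {A : Set} (xs ys : List A) {n} → length xs ≡ n → List.drop n (xs ++ ys) ≡ ys
drop-exact [] ys refl = refl
drop-exact (x ∷ xs) ys refl = drop-exact xs ys refl

liftAll-code : ∀ H rest → (∀ {E} → E ∈ H → Sorted E) → liftAll (map halve H) (liftCode H ++ rest) ≡ H
liftAll-code [] rest _ = refl
liftAll-code (E ∷ H) rest srt = cong₂ _∷_
  (trans (cong (liftEdge (halve E)) (trans (cong (take (length (halve E))) assoc) (take-exact os _ len)))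
    (liftEdge-halve (srt (here refl))))
  (trans (cong (liftAll (map halve H))
    (trans (cong (List.drop (length (halve E))) assoc) (drop-exact os _ len))) (liftAll-code H rest (srt ∘ there)))
  where
  os = map (offsetsAt E) (halve E)
  len : length os ≡ length (halve E)
  len = length-map (offsetsAt E) (halve E)
  assoc : (os ++ liftCode H) ++ rest ≡ os ++ (liftCode H ++ rest)
  assoc = ++-assoc os (liftCode H) rest

length-liftCode : ∀ H → length (liftCode H) ≤ weight H
length-liftCode [] = z≤n
length-liftCode (E ∷ H) = ≤-trans (≤-reflexive (length-++ (map (offsetsAt E) (halve E))))
  (+-mono-≤ (≤-trans (≤-reflexive (length-map (offsetsAt E) (halve E))) (length-halve E)) (length-liftCode H))

liftCode-∈ : ∀ H → All (_∈ offsets) (liftCode H)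
liftCode-∈ [] = []
liftCode-∈ (E ∷ H) = All.++⁺ (All.map⁺ (All.tabulate λ {c} _ → offsetsAt-∈ E c)) (liftCode-∈ H)

weight-↭ : ∀ {G H : List Edge} → G ↭ H → weight G ≡ weight H
weight-↭ _↭_.refl = refl
weight-↭ (_↭_.prep E p) = cong (length E +_) (weight-↭ p)
weight-↭ (_↭_.swap E F p) = trans (cong (λ w → length E + (length F + w)) (weight-↭ p))
  (swap (length E) (length F) _)
  where
  swap : ∀ a b c → a + (b + c) ≡ b + (a + c)
  swap = solve-∀
weight-↭ (_↭_.trans p q) = trans (weight-↭ p) (weight-↭ q)

decodeStep : ∀ {a b} → List Edge → Vec Bool a × Vec (List ℕ) b → List Edge
decodeStep Ps (bs , os) = liftAll (repeatBy Ps (Vec.toList bs)) (Vec.toList os)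

-- `a` is the budget of bits that tell how many edges lie over each parent, `b` that of offsets that
-- tell how the cells split.
refine : ℕ → ℕ → List (List Edge) → List (List Edge)
refine a b ys = cartesianProductWith decodeStep ys (cartesianProduct (vectors bools a) (vectors offsets b))

length-refine : ∀ a b ys → length (refine a b ys) ≤ length ys * (2 ^ a * 4 ^ b)
length-refine a b ys = begin
  length (refine a b ys) ≡⟨ length-cartesianProductWith decodeStep ys _ ⟩
  length ys * length (cartesianProduct (vectors bools a) (vectors offsets b))
    ≡⟨ cong (length ys *_) (length-cartesianProductWith _,_ (vectors bools a) (vectors offsets b)) ⟩
  length ys * (length (vectors bools a) * length (vectors offsets b))
    ≤⟨ *-monoʳ-≤ (length ys) (*-mono-≤ (length-vectors bools a) (length-vectors offsets b)) ⟩
  length ys * (2 ^ a * 4 ^ b) ∎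
  where open ≤-Reasoning

refine-covers : ∀ {a b ys H} → (∀ {E} → E ∈ H → Sorted E) → length H + length (parents H) ≤ a → weight H ≤ b →
  (∃ λ Ps → Ps ∈ ys × Ps ↭ parents H) → ∃ λ G → G ∈ refine a b ys × G ↭ H
refine-covers {a} {b} {ys} {H} srt ≤a ≤b (Ps , Ps∈ , Ps↭) =
  decodeStep Ps (bs , os) ,
  ∈-cartesianProductWith⁺ decodeStep Ps∈ (∈-cartesianProduct⁺ bs∈ os∈) ,
  subst (_↭ H) (sym decoded) G↭H
  where
  open Grouping halve edge-≟
  G = group H Ps
  t : Edge → ℕ
  t P = length (fibre H P)
  G↭H : G ↭ H
  G↭H = group-↭ H (Unique-resp-↭ (↭-sym Ps↭) (DecUnique.deduplicate-! edge-≟ (map halve H)))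
    (λ E∈ → ↭.∈-resp-↭ (↭-sym Ps↭) (parents⁺ E∈))
  bits≤ : length (unary t Ps) ≤ a
  bits≤ = ≤-trans (≤-reflexive (trans (length-unary t Ps) (cong₂ _+_
    (trans (cong length (sym (map-group H Ps))) (trans (length-map halve G) (↭.↭-length G↭H)))
    (↭.↭-length Ps↭)))) ≤a
  code≤ : length (liftCode G) ≤ b
  code≤ = ≤-trans (length-liftCode G) (≤-trans (≤-reflexive (weight-↭ G↭H)) ≤b)
  bits = vector-extends (∈-bools false) a (unary t Ps) (All.tabulate λ {x} _ → ∈-bools x) bits≤
  code = vector-extends {alphabet = offsets} (here refl) b (liftCode G) (liftCode-∈ G) code≤
  bs = proj₁ bits
  bs∈ = proj₁ (proj₂ bits)
  os = proj₁ code
  os∈ = proj₁ (proj₂ code)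
  decoded : decodeStep Ps (bs , os) ≡ G
  decoded = begin
    liftAll (repeatBy Ps (Vec.toList bs)) (Vec.toList os)
      ≡⟨ cong₂ (λ b o → liftAll (repeatBy Ps b) o) (proj₂ (proj₂ (proj₂ bits))) (proj₂ (proj₂ (proj₂ code))) ⟩
    liftAll (repeatBy Ps (unary t Ps ++ rb)) (liftCode G ++ rc)
      ≡⟨ cong (λ Qs → liftAll Qs (liftCode G ++ rc)) (trans (repeatBy-unary t Ps rb) (sym (map-group H Ps))) ⟩
    liftAll (map halve G) (liftCode G ++ rc) ≡⟨ liftAll-code G rc (λ E∈ → srt (↭.∈-resp-↭ G↭H E∈)) ⟩
    G ∎
    where
    open ≡-Reasoning
    rb = proj₁ (proj₂ (proj₂ bits))
    rc = proj₁ (proj₂ (proj₂ code))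

length≤weight : ∀ (H : List Edge) → (∀ {E} → E ∈ H → 1 ≤ length E) → length H ≤ weight H
length≤weight [] _ = z≤n
length≤weight (E ∷ H) ne = +-mono-≤ (ne (here refl)) (length≤weight H (ne ∘ there))

module Covers (m′ d′ : ℕ) (σ : ℕ → Fin (suc m′) → Fin (suc m′)) (σ-id : ∀ i → σ 0 i ≡ i) where

  open Weights m′ d′ σ σ-id

  Cw : ℕ
  Cw = p * C₀ + 2 * p * (m * C₀)

  size : ℕ → ℕ
  size a = (2 ^ a) ^ d

  cover : ℕ → List (List Edge)
  -- On a single vertex there are only the empty hypergraph and the one whose edge is `[ 0 ]`.
  cover zero    = [] ∷ [ [ 0 ] ] ∷ []
  cover (suc a) = refine (2 * (Cw * size (suc a))) (Cw * size (suc a)) (cover a)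

  parents-avoiding : ∀ {H} → Avoiding H → Avoiding (parents H)
  parents-avoiding {H} av cp = av (halve-contains (parents⁻ {H}) cp)

  singleton-edge : ∀ {H E} → Hypergraph 1 H → E ∈ H → E ≡ [ 0 ]
  singleton-edge {E = []} hyp E∈ with () ← Hypergraph.nonempty hyp E∈
  singleton-edge {E = x ∷ []} hyp E∈ = cong [_] (n<1⇒n≡0 (Hypergraph.bounded hyp E∈ (here refl)))
  singleton-edge {E = x ∷ y ∷ E} hyp E∈ with Hypergraph.sorted hyp E∈
  ... | (x<y ∷ _) ∷ _ = contradiction (<-≤-trans x<y (≤-pred (Hypergraph.bounded hyp E∈ (there (here refl))))) λ ()

  cover-complete : ∀ a H → Unique H → Hypergraph (2 ^ a) H → Avoiding H → ∃ λ G → G ∈ cover a × G ↭ H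
  cover-complete zero [] uH hyp av = [] , here refl , ↭-refl
  cover-complete zero (E ∷ []) uH hyp av with singleton-edge hyp (here refl)
  ... | refl = [ [ 0 ] ] , there (here refl) , ↭-refl
  cover-complete zero (E ∷ F ∷ H) ((E≢F ∷ _) ∷ _) hyp av =
    contradiction (trans (singleton-edge hyp (here refl)) (sym (singleton-edge hyp (there (here refl))))) E≢F
  cover-complete (suc a) H uH hyp av = refine-covers (Hypergraph.sorted hyp)
    (≤-trans (+-mono-≤ length≤ (≤-trans (length-parents H) length≤))
      (≤-reflexive (cong (Cw * size (suc a) +_) (sym (+-identityʳ _)))))
    weight≤
    (cover-complete a (parents H) (DecUnique.deduplicate-! edge-≟ (map halve H))
      (halve-hypergraph (parents⁻ {H}) hyp) (parents-avoiding av))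
    where
    weight≤ : weight H ≤ Cw * size (suc a)
    weight≤ = weight-bound (m^n>0 2 (suc a)) uH hyp av
    length≤ : length H ≤ Cw * size (suc a)
    length≤ = ≤-trans (length≤weight H (Hypergraph.nonempty hyp)) weight≤

  -- Write W for `Cw * size (suc a)`. Passing to scale `2 ^ suc a` costs 4W bits: 2W for the
  -- multiplicities and two for each of W offsets. As `size` at least doubles, half of
  -- `Γ * size (suc a)` is free for this, which is enough once `Γ` is at least `8 * Cw`. The
  -- successor pays for the two hypergraphs of `cover zero`.
  Γ : ℕ
  Γ = suc (8 * Cw)

  length-cover : ∀ a → length (cover a) ≤ 2 ^ (Γ * size a)
  length-cover zero = begin
    2 ≤⟨ ^-monoʳ-≤ 2 {1} {Γ} (s≤s z≤n) ⟩
    2 ^ Γ ≡⟨ cong (2 ^_) (sym (trans (cong (Γ *_) (^-zeroˡ d)) (*-identityʳ Γ))) ⟩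
    2 ^ (Γ * size 0) ∎
    where open ≤-Reasoning
  length-cover (suc a) = begin
    length (cover (suc a)) ≤⟨ length-refine (2 * W) W (cover a) ⟩
    length (cover a) * (2 ^ (2 * W) * 4 ^ W) ≤⟨ *-monoˡ-≤ (2 ^ (2 * W) * 4 ^ W) (length-cover a) ⟩
    2 ^ (Γ * size a) * (2 ^ (2 * W) * 4 ^ W) ≡⟨ cong (λ z → 2 ^ (Γ * size a) * (2 ^ (2 * W) * z))
      (^-*-assoc 2 2 W) ⟩
    2 ^ (Γ * size a) * (2 ^ (2 * W) * 2 ^ (2 * W)) ≡⟨ cong (2 ^ (Γ * size a) *_)
      (^-distribˡ-+-* 2 (2 * W) (2 * W)) ⟨
    2 ^ (Γ * size a) * 2 ^ (2 * W + 2 * W) ≡⟨ ^-distribˡ-+-* 2 (Γ * size a) (2 * W + 2 * W) ⟨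
    2 ^ (Γ * size a + (2 * W + 2 * W)) ≤⟨ ^-monoʳ-≤ 2 exponent ⟩
    2 ^ (Γ * size (suc a)) ∎
    where
    open ≤-Reasoning
    X = size (suc a)
    W = Cw * X
    doubling : 2 * size a ≤ X
    doubling = begin
      2 * size a            ≤⟨ *-monoˡ-≤ (size a) (^-monoʳ-≤ 2 {1} {d} (s≤s z≤n)) ⟩
      2 ^ d * size a        ≡⟨ ^-distribʳ-* d 2 (2 ^ a) ⟨
      X                     ∎
    exponent : Γ * size a + (2 * W + 2 * W) ≤ Γ * X
    exponent = *-cancelˡ-≤ 2 (begin
      2 * (Γ * size a + (2 * W + 2 * W))   ≡⟨ expand (size a) Cw X ⟩
      Γ * (2 * size a) + 8 * Cw * X        ≤⟨ +-mono-≤ (*-monoʳ-≤ Γ doubling) (*-monoˡ-≤ X (n≤1+n (8 * Cw))) ⟩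
      Γ * X + Γ * X                        ≡⟨ cong (Γ * X +_) (+-identityʳ (Γ * X)) ⟨
      2 * (Γ * X)                          ∎)
      where
      expand : ∀ s c x → 2 * (suc (8 * c) * s + (2 * (c * x) + 2 * (c * x))) ≡ suc (8 * c) * (2 * s) + 8 * c * x
      expand = solve-∀

  -- Here the edges may repeat: blocks with the same shadow remain separate entries, so that a
  -- position in the list names a block. `weight-bound` speaks of distinct edges, so the budget `n`
  -- comes from the total size of the blocks instead.
  finalCover : ℕ → ℕ → List (List Edge)
  finalCover n a = refine (2 * n) n (cover a)

  finalCover-complete : ∀ {n a H} → Hypergraph (2 ^ suc a) H → Avoiding H → weight H ≤ n →
    ∃ λ G → G ∈ finalCover n a × G ↭ H
  finalCover-complete {n} {a} {H} hyp av ≤n = refine-covers (Hypergraph.sorted hyp)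
    (≤-trans (+-mono-≤ length≤ (≤-trans (length-parents H) length≤))
      (≤-reflexive (cong (n +_) (sym (+-identityʳ n))))) ≤n
    (cover-complete a (parents H) (DecUnique.deduplicate-! edge-≟ (map halve H))
      (halve-hypergraph (parents⁻ {H}) hyp) (parents-avoiding av))
    where
    length≤ : length H ≤ n
    length≤ = ≤-trans (length≤weight H (Hypergraph.nonempty hyp)) ≤n

  length-finalCover : ∀ {n a} → size a ≤ n → length (finalCover n a) ≤ 2 ^ ((Γ + 4) * n)
  length-finalCover {n} {a} ≤n = begin
    length (finalCover n a) ≤⟨ length-refine (2 * n) n (cover a) ⟩
    length (cover a) * (2 ^ (2 * n) * 4 ^ n)
      ≤⟨ *-mono-≤ (≤-trans (length-cover a) (^-monoʳ-≤ 2 (*-monoʳ-≤ Γ ≤n)))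
        (≤-reflexive (cong (2 ^ (2 * n) *_) (^-*-assoc 2 2 n))) ⟩
    2 ^ (Γ * n) * (2 ^ (2 * n) * 2 ^ (2 * n)) ≡⟨ cong (2 ^ (Γ * n) *_) (^-distribˡ-+-* 2 (2 * n) (2 * n)) ⟨
    2 ^ (Γ * n) * 2 ^ (2 * n + 2 * n) ≡⟨ ^-distribˡ-+-* 2 (Γ * n) (2 * n + 2 * n) ⟨
    2 ^ (Γ * n + (2 * n + 2 * n)) ≡⟨ cong (2 ^_) (collect Γ n) ⟩
    2 ^ ((Γ + 4) * n) ∎
    where
    open ≤-Reasoning
    collect : ∀ g n → g * n + (2 * n + 2 * n) ≡ (g + 4) * n
    collect = solve-∀

-- Set partitions as hypergraphs


allF⁻ : ∀ {n} {P : Fin n → Bool} → T (allF P) → ∀ i → T (P i)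
allF⁻ {n} {P} t i = All.lookup (All.all⁺ P (allFin n) t) (∈-allFin i)

allF⁺ : ∀ {n} {P : Fin n → Bool} → (∀ i → T (P i)) → T (allF P)
allF⁺ {n} {P} t = All.all⁻ P (All.tabulate {xs = allFin n} λ {i} _ → t i)

==b⇒≡ : ∀ {a b} → T (a ==b b) → a ≡ b
==b⇒≡ {true}  {true}  _ = refl
==b⇒≡ {false} {false} _ = refl

≡⇒==b : ∀ {a b} → a ≡ b → T (a ==b b)
≡⇒==b {true}  refl = _
≡⇒==b {false} refl = _

⇒b-elim : ∀ {a b} → T (a ⇒b b) → T a → T b
⇒b-elim {true} t _ = t

record IsEquivalenceᵇ {n} (R : Rel n) : Set where
  field
    reflexive  : ∀ i → T (R i i)
    symmetric  : ∀ {i j} → T (R i j) → T (R j i)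
    transitive : ∀ {i j k} → T (R i j) → T (R j k) → T (R i k)

isEquiv⇒ : ∀ {n} {R : Rel n} → T (isEquiv R) → IsEquivalenceᵇ R
isEquiv⇒ {n} {R} t = record
  { reflexive  = allF⁻ (proj₁ parts)
  ; symmetric  = λ {i} {j} → ⇒b-elim (allF⁻ (allF⁻ (proj₁ parts′) i) j)
  ; transitive = λ {i} {j} {k} Rij Rjk →
      ⇒b-elim (allF⁻ (allF⁻ (allF⁻ (proj₂ parts′) i) j) k) (Equivalence.from T-∧ (Rij , Rjk))
  }
  where
  parts = Equivalence.to (T-∧ {allF (λ i → R i i)}) t
  parts′ = Equivalence.to (T-∧ {allF (λ i → allF (λ j → R i j ⇒b R j i))}) (proj₂ parts)

∈-allThins : ∀ {M N} (θ : Thin M N) → θ ∈ allThins M N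
∈-allThins done = here refl
∈-allThins (keep θ) = ∈-++⁺ˡ (∈-map⁺ keep (∈-allThins θ))
∈-allThins {zero}  (drop θ) = ∈-map⁺ drop (∈-allThins θ)
∈-allThins {suc M} {suc N} (drop θ) = ∈-++⁺ʳ (map keep (allThins M N)) (∈-map⁺ drop (∈-allThins θ))

contains⁻ : ∀ {N M} {R : Rel N} {P : Rel M} → Contains R P → ∃ λ θ → ∀ i j → R (embed θ i) (embed θ j) ≡ P i j
contains⁻ {N} {M} t with find (Any.any⁻ _ (allThins M N) t)
... | θ , _ , eq = θ , λ i j → ==b⇒≡ (allF⁻ (allF⁻ eq i) j)

contains⁺ : ∀ {N M} {R : Rel N} {P : Rel M} (θ : Thin M N) → (∀ i j → R (embed θ i) (embed θ j) ≡ P i j) →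
  Contains R P
contains⁺ θ eq = Any.any⁺ _ (lose (∈-allThins θ) (allF⁺ λ i → allF⁺ λ j → ≡⇒==b (eq i j)))

_⊙_ : ∀ {L M N} → Thin M N → Thin L M → Thin L N
done     ⊙ ψ        = ψ
drop θ   ⊙ ψ        = drop (θ ⊙ ψ)
keep θ   ⊙ (keep ψ) = keep (θ ⊙ ψ)
keep θ   ⊙ (drop ψ) = drop (θ ⊙ ψ)

embed-⊙ : ∀ {L M N} (θ : Thin M N) (ψ : Thin L M) i → embed (θ ⊙ ψ) i ≡ embed θ (embed ψ i)
embed-⊙ done     done     ()
embed-⊙ (drop θ) ψ        i       = cong suc (embed-⊙ θ ψ i)
embed-⊙ (keep θ) (keep ψ) zero    = refl
embed-⊙ (keep θ) (keep ψ) (suc i) = cong suc (embed-⊙ θ ψ i)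
embed-⊙ (keep θ) (drop ψ) i       = cong suc (embed-⊙ θ ψ i)

Contains-trans : ∀ {L M N} {R : Rel N} {Q : Rel M} {P : Rel L} → Contains R Q → Contains Q P → Contains R P
Contains-trans {R = R} {Q} {P} RQ QP with contains⁻ {R = R} {Q} RQ | contains⁻ {R = Q} {P} QP
... | θ , eq | ψ , eq′ = contains⁺ {R = R} {P} (θ ⊙ ψ) λ i j →
  trans (cong₂ R (embed-⊙ θ ψ i) (embed-⊙ θ ψ j)) (trans (eq (embed ψ i) (embed ψ j)) (eq′ i j))

lower : ∀ {N} (x : Fin (suc N)) → 0 < toℕ x → Fin N
lower (suc x) _ = x

suc-lower : ∀ {N} (x : Fin (suc N)) 0<x → suc (lower x 0<x) ≡ x
suc-lower (suc x) _ = refl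

lower-mono : ∀ {N} {x y : Fin (suc N)} 0<x 0<y → x Fin.< y → lower x 0<x Fin.< lower y 0<y
lower-mono {x = suc x} {suc y} _ _ (s≤s lt) = lt

thin : ∀ {M N} (f : Fin M → Fin N) → (∀ {i j} → i Fin.< j → f i Fin.< f j) → ∃ λ θ → ∀ i → embed θ i ≡ f i
thin {zero}  {zero}  f mono = done , λ ()
thin {suc M} {zero}  f mono with () ← f zero
thin {zero}  {suc N} f mono with thin {zero} {N} (λ ()) (λ { {()} })
... | θ , _ = drop θ , λ ()
thin {suc M} {suc N} f mono with f zero in f0
... | zero with thin {M} {N} (λ i → lower (f (suc i)) (pos i)) (λ lt → lower-mono (pos _) (pos _) (mono (s≤s lt)))
  where
  pos : ∀ i → 0 < toℕ (f (suc i))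
  pos i = subst (λ z → toℕ z < toℕ (f (suc i))) f0 (mono (s≤s z≤n))
...   | θ , eq = keep θ , λ { zero → sym f0 ; (suc i) → trans (cong suc (eq i)) (suc-lower (f (suc i)) _) }
thin {suc M} {suc N} f mono | suc y with thin {suc M} {N} (λ i → lower (f i) (pos i))
  (λ lt → lower-mono (pos _) (pos _) (mono lt))
  where
  pos : ∀ i → 0 < toℕ (f i)
  pos zero    = subst (λ z → 0 < toℕ z) (sym f0) (s≤s z≤n)
  pos (suc i) = ≤-<-trans z≤n (mono {zero} {suc i} (s≤s z≤n))
...   | θ , eq = drop θ , λ i → trans (cong suc (eq i)) (suc-lower (f i) _)

contains-mono : ∀ {N M} {R : Rel N} {P : Rel M} (f : Fin M → Fin N) → (∀ {i j} → i Fin.< j → f i Fin.< f j) →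
  (∀ i j → R (f i) (f j) ≡ P i j) → Contains R P
contains-mono {R = R} {P} f mono eq with thin f mono
... | θ , θ≗f = contains⁺ {R = R} {P} θ λ i j → trans (cong₂ R (θ≗f i) (θ≗f j)) (eq i j)

allFin-sorted : ∀ n → AllPairs Fin._<_ (allFin n)
allFin-sorted n = AllPairs.tabulate⁺-< id

AllPairs-map-∈ : ∀ {A : Set} {R S : A → A → Set} {xs} → (∀ {x y} → x ∈ xs → y ∈ xs → R x y → S x y) →
  AllPairs R xs → AllPairs S xs
AllPairs-map-∈ f [] = []
AllPairs-map-∈ f (r ∷ rs) = All.tabulate (λ y∈ → f (here refl) (there y∈) (All.lookup r y∈)) ∷
  AllPairs-map-∈ (λ x∈ y∈ → f (there x∈) (there y∈)) rs

weight-concat : ∀ (H : List Edge) → weight H ≡ length (concat H)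
weight-concat [] = refl
weight-concat (E ∷ H) = trans (cong (length E +_) (weight-concat H)) (sym (length-++ E))

-- The block T_i of [σ₁,…,σ_d] has offset order σs l i in layer l.
permute : ∀ {d m} → Vec (Permutation′ m) d → ℕ → Fin m → Fin m
permute []       _       i = i
permute (τ ∷ _)  zero    i = τ ⟨$⟩ʳ i
permute (_ ∷ σs) (suc l) i = permute σs l i

order : ∀ {d m} → Vec (Permutation′ m) d → ℕ → Fin m → Fin m
order σs zero    i = i
order σs (suc l) i = permute σs l i

permute-lookup : ∀ {d m} (σs : Vec (Permutation′ m) d) k i → permute σs (toℕ k) i ≡ Vec.lookup σs k ⟨$⟩ʳ i
permute-lookup (_ ∷ _)  zero    i = refl
permute-lookup (_ ∷ σs) (suc k) i = permute-lookup σs k i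

layer : ∀ {d m} → Fin (suc d * m) → Fin (suc d)
layer {d} {m} q = proj₁ (Fin.remQuot {suc d} m q)

offset : ∀ {d m} → Fin (suc d * m) → Fin m
offset {d} {m} q = proj₂ (Fin.remQuot {suc d} m q)

-- In a layer after the first, the label is the inverse permutation applied to the offset, and
-- `order` applies the permutation again. The split on `splitAt` follows the way `remQuot` computes,
-- with layer 0 as the first summand.
order-blockLabel : ∀ {d m} (σs : Vec (Permutation′ m) d) q →
  order σs (toℕ (layer {d} {m} q)) (blockLabel σs q) ≡ offset {d} {m} q
order-blockLabel {d} {m} σs q with Fin.splitAt m q
... | inj₁ r  = refl
... | inj₂ q′ = trans (permute-lookup σs k _) (inverseʳ (Vec.lookup σs k))
  where k = proj₁ (Fin.remQuot {d} m q′)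

lexicographic : ∀ {d m} {q q′ : Fin (suc d * m)} → q Fin.< q′ →
  layer {d} {m} q Fin.< layer {d} {m} q′ ⊎
    (layer {d} {m} q ≡ layer {d} {m} q′ × offset {d} {m} q Fin.< offset {d} {m} q′)
lexicographic {d} {m} {q} {q′} lt with Fin.<-cmp (layer {d} {m} q) (layer {d} {m} q′)
... | tri< l<l′ _ _ = inj₁ l<l′
... | tri≈ _ l≡l′ _ = inj₂ (l≡l′ , +-cancelˡ-< (m * toℕ (layer {d} {m} q)) _ _
        (subst₂ _<_ (toℕ-split q) (trans (toℕ-split q′)
          (cong (λ l → m * toℕ l + toℕ (offset {d} {m} q′)) (sym l≡l′))) lt))
  where
  toℕ-split : ∀ q → toℕ q ≡ m * toℕ (layer {d} {m} q) + toℕ (offset {d} {m} q)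
  toℕ-split q = trans (cong toℕ (sym (Fin.combine-remQuot {suc d} m q)))
    (Fin.toℕ-combine (layer {d} {m} q) (offset {d} {m} q))
... | tri> _ _ l>l′ = contradiction lt
    (<-asym (subst₂ Fin._<_ (Fin.combine-remQuot {suc d} m q′) (Fin.combine-remQuot {suc d} m q)
        (Fin.combine-monoˡ-< (offset {d} {m} q′) (offset {d} {m} q) l>l′)))

module Blocks {n} (R : Rel n) (equiv : IsEquivalenceᵇ R) where

  open IsEquivalenceᵇ equiv

  block : Fin n → Edge
  block i = map toℕ (filter (λ j → T? (R i j)) (allFin n))

  ∈-block⁻ : ∀ {i z} → z ∈ block i → ∃ λ j → z ≡ toℕ j × T (R i j)
  ∈-block⁻ {i} z∈ with ∈-map⁻ toℕ z∈
  ... | j , j∈ , eq = j , eq , proj₂ (∈-filter⁻ (λ j → T? (R i j)) {xs = allFin n} j∈)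

  ∈-block⁺ : ∀ {i j} → T (R i j) → toℕ j ∈ block i
  ∈-block⁺ {i} {j} Rij = ∈-map⁺ toℕ (∈-filter⁺ (λ j → T? (R i j)) (∈-allFin j) Rij)

  block-≡ : ∀ {i j} → T (R i j) → block i ≡ block j
  block-≡ {i} {j} Rij = cong (map toℕ) (filter-cong-∈ (λ k → T? (R i k)) (λ k → T? (R j k)) (allFin n)
    (λ _ Rik → transitive (symmetric Rij) Rik) (λ _ Rjk → transitive Rij Rjk))

  block-≡⁻ : ∀ {i j} → block i ≡ block j → T (R i j)
  block-≡⁻ {i} {j} eq with ∈-block⁻ {i} (subst (toℕ j ∈_) (sym eq) (∈-block⁺ (reflexive j)))
  ... | k , j≡k , Rik rewrite Fin.toℕ-injective j≡k = Rik

  block-meet : ∀ {i j z} → z ∈ block i → z ∈ block j → block i ≡ block j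
  block-meet {i} {j} z∈ z∈′ with ∈-block⁻ {i} z∈ | ∈-block⁻ {j} z∈′
  ... | k , refl , Rik | k′ , eq , Rjk′ rewrite Fin.toℕ-injective eq = trans (block-≡ Rik) (sym (block-≡ Rjk′))

  block-sorted : ∀ i → Sorted (block i)
  block-sorted i = AllPairs.map⁺ (AllPairs.filter⁺ _ (allFin-sorted n))

  blocks : List Edge
  blocks = deduplicate edge-≟ (map block (allFin n))

  blocks-unique : Unique blocks
  blocks-unique = DecUnique.deduplicate-! edge-≟ (map block (allFin n))

  blocks⁻ : ∀ {E} → E ∈ blocks → ∃ λ i → E ≡ block i
  blocks⁻ E∈ with ∈-map⁻ block (∈-deduplicate⁻ edge-≟ (map block (allFin n)) E∈)
  ... | i , _ , eq = i , eq

  blocks⁺ : ∀ i → block i ∈ blocks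
  blocks⁺ i = ∈-deduplicate⁺ edge-≟ (∈-map⁺ block (∈-allFin i))

  blocks-meet : ∀ {E F z} → E ∈ blocks → F ∈ blocks → z ∈ E → z ∈ F → E ≡ F
  blocks-meet E∈ F∈ z∈E z∈F with blocks⁻ E∈ | blocks⁻ F∈
  ... | i , refl | j , refl = block-meet {i} {j} z∈E z∈F

  blocks-hypergraph : ∀ {N} → n ≤ N → Hypergraph N blocks
  blocks-hypergraph {N} n≤N = record { sorted = srt ; nonempty = ne ; bounded = bd }
    where
    srt : ∀ {E} → E ∈ blocks → Sorted E
    srt E∈ with blocks⁻ E∈
    ... | i , refl = block-sorted i
    ne : ∀ {E} → E ∈ blocks → 1 ≤ length E
    ne E∈ with blocks⁻ E∈
    ... | i , refl = ∈-length (∈-block⁺ (reflexive i))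
    bd : ∀ {E} → E ∈ blocks → ∀ {z} → z ∈ E → z < N
    bd E∈ z∈ with blocks⁻ E∈
    ... | i , refl with ∈-block⁻ {i} z∈
    ...   | j , refl , _ = <-≤-trans (Fin.toℕ<n j) n≤N

  weight-blocks : weight blocks ≤ n
  weight-blocks = begin
    weight blocks            ≡⟨ weight-concat blocks ⟩
    length (concat blocks)   ≤⟨ length-mono-⊆ unique sub ⟩
    length (upTo n)          ≡⟨ length-upTo n ⟩
    n                        ∎
    where
    open ≤-Reasoning
    open Hypergraph (blocks-hypergraph ≤-refl)
    unique : Unique (concat blocks)
    unique = Unique.concat⁺ (All.tabulate (Sorted⇒Unique ∘ sorted))
      (AllPairs-map-∈ (λ E∈ F∈ E≢F (z∈E , z∈F) → E≢F (blocks-meet E∈ F∈ z∈E z∈F)) blocks-unique)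
    sub : ∀ {z} → z ∈ concat blocks → z ∈ upTo n
    sub z∈ with ∈-concat⁻′ blocks z∈
    ... | E , z∈E , E∈ = ∈-upTo⁺ (bounded E∈ z∈E)

  -- A position of `[σ₁,…,σ_d]` is sent to the vertex that the edge with its label has in its layer.
  -- Positions are ordered lexicographically: `across` compares different layers, `within` compares
  -- offsets in one layer. Distinct edges are distinct blocks, so unequal labels give unrelated
  -- points.
  pattern⇒contains : ∀ {d m} (σs : Vec (Permutation′ m) d) →
    ContainsPattern m d (order σs) blocks → Contains R (permPartition σs)
  pattern⇒contains {d} {m} σs cp = contains-mono {R = R} {permPartition σs} f mono agree
    where
    open ContainsPattern cp
    rep : Fin m → Fin n
    rep i = proj₁ (blocks⁻ (e∈ i))
    element : ∀ i l → ∃ λ j → x i l ≡ toℕ j × T (R (rep i) j)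
    element i l = ∈-block⁻ {rep i} (subst (x i l ∈_) (proj₂ (blocks⁻ (e∈ i))) (x∈ i l))
    label = blockLabel σs
    f : Fin (suc d * m) → Fin n
    f q = proj₁ (element (label q) (layer {d} {m} q))
    f-x : ∀ q → x (label q) (layer {d} {m} q) ≡ toℕ (f q)
    f-x q = proj₁ (proj₂ (element (label q) (layer {d} {m} q)))
    f-R : ∀ q → T (R (rep (label q)) (f q))
    f-R q = proj₂ (proj₂ (element (label q) (layer {d} {m} q)))
    mono : ∀ {q q′} → q Fin.< q′ → f q Fin.< f q′
    mono {q} {q′} lt = subst₂ _<_ (f-x q) (f-x q′) (below (lexicographic {d} {m} lt))
      where
      below : _ → x (label q) (layer {d} {m} q) < x (label q′) (layer {d} {m} q′)
      below (inj₁ l<l′) = across (label q) (label q′) l<l′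
      below (inj₂ (l≡l′ , r<r′)) = subst (λ l → x (label q) (layer {d} {m} q) < x (label q′) l) l≡l′
        (within (layer {d} {m} q) (subst₂ Fin._<_ (sym (order-blockLabel σs q))
          (sym (trans (cong (λ l → order σs (toℕ l) (label q′)) l≡l′) (order-blockLabel σs q′))) r<r′))
    agree : ∀ q q′ → R (f q) (f q′) ≡ permPartition σs q q′
    agree q q′ with label q Fin.≟ label q′
    ... | yes eq = Equivalence.to T-≡
        (transitive (symmetric (f-R q)) (subst (λ i → T (R (rep i) (f q′))) (sym eq) (f-R q′)))
    ... | no ≢ with R (f q) (f q′) in Rff
    ...   | false = refl
    ...   | true  = contradiction same (distinct ≢)
      where
      same : e (label q) ≡ e (label q′)
      same = trans (proj₂ (blocks⁻ (e∈ (label q)))) (trans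
        (block-≡ (transitive (f-R q) (transitive (Equivalence.from T-≡ Rff) (symmetric (f-R q′)))))
        (sym (proj₂ (blocks⁻ (e∈ (label q′))))))

-- Recovering a partition from the shadows of its blocks

-- The number of the interval of length `2 ^ b` that contains `z`, iterated in the same way as
-- `halves`.
shift : ℕ → ℕ → ℕ
shift zero    z = z
shift (suc b) z = ⌊ shift b z /2⌋

shift-range : ∀ b z → ∃ λ r → r < 2 ^ b × z ≡ shift b z * 2 ^ b + r
shift-range zero z = 0 , s≤s z≤n , sym (trans (+-identityʳ _) (*-identityʳ z))
shift-range (suc b) z with shift-range b z | is-child (shift b z)
... | r , r< , eq | o , o∈ , eq′ = o * 2 ^ b + r , bound o∈ ,
  trans eq (trans (cong (λ v → v * 2 ^ b + r) eq′) (regroup o ⌊ shift b z /2⌋ (2 ^ b) r))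
  where
  regroup : ∀ o h k r → (o + 2 * h) * k + r ≡ h * (2 * k) + (o * k + r)
  regroup = solve-∀
  bound : o ∈ 0 ∷ 1 ∷ [] → o * 2 ^ b + r < 2 ^ suc b
  bound (here refl)         = <-≤-trans r< (m≤m+n (2 ^ b) _)
  bound (there (here refl)) = <-≤-trans (+-monoʳ-< (1 * 2 ^ b) r<)
    (≤-reflexive (trans (+-comm (1 * 2 ^ b) (2 ^ b)) refl))

halves : ℕ → Edge → Edge
halves zero    E = E
halves (suc b) E = halve (halves b E)

halves-[] : ∀ b → halves b [] ≡ []
halves-[] zero    = refl
halves-[] (suc b) = cong halve (halves-[] b)

∈-halves⁺ : ∀ b {E z} → z ∈ E → shift b z ∈ halves b E
∈-halves⁺ zero    z∈ = z∈
∈-halves⁺ (suc b) z∈ = ∈-halve⁺ (∈-halves⁺ b z∈)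

∈-halves⁻ : ∀ b {E v} → v ∈ halves b E → ∃ λ z → z ∈ E × v ≡ shift b z
∈-halves⁻ zero    v∈ = _ , v∈ , refl
∈-halves⁻ (suc b) {E} v∈ with ∈-halve⁻ {halves b E} v∈
... | w , w∈ , refl with ∈-halves⁻ b w∈
...   | z , z∈ , refl = z , z∈ , refl

halves-step : ∀ b {H E} → E ∈ map (halves (suc b)) H → ∃ λ E₀ → E₀ ∈ map (halves b) H × E ≡ halve E₀
halves-step b E∈ with ∈-map⁻ (halves (suc b)) E∈
... | F , F∈ , eq = halves b F , ∈-map⁺ (halves b) F∈ , eq

halves-hypergraph : ∀ b {a H} → Hypergraph (2 ^ (b + a)) H → Hypergraph (2 ^ a) (map (halves b) H)
halves-hypergraph zero {a} {H} hyp = subst (Hypergraph (2 ^ a)) (sym (List.map-id H)) hyp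
halves-hypergraph (suc b) {a} {H} hyp = halve-hypergraph (halves-step b {H})
  (halves-hypergraph b {suc a} (subst (λ e → Hypergraph (2 ^ e) H) (sym (+-suc b a)) hyp))

halves-contains : ∀ {m d σ} b {H} → ContainsPattern m d σ (map (halves b) H) → ContainsPattern m d σ H
halves-contains {m} {d} {σ} zero {H} cp = subst (ContainsPattern m d σ) (List.map-id H) cp
halves-contains (suc b) {H} cp = halves-contains b (halve-contains (halves-step b {H}) cp)

weight-halves : ∀ b H → weight (map (halves b) H) ≤ weight H
weight-halves b [] = z≤n
weight-halves b (E ∷ H) = +-mono-≤ (go b) (weight-halves b H)
  where
  go : ∀ b → length (halves b E) ≤ length E
  go zero    = ≤-refl
  go (suc b) = ≤-trans (length-halve (halves b E)) (go b)

at : List Edge → ℕ → Edge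
at []      _       = []
at (E ∷ H) zero    = E
at (E ∷ H) (suc i) = at H i

at-∈ : ∀ {H i} → i < length H → at H i ∈ H
at-∈ {E ∷ H} {zero}  _       = here refl
at-∈ {E ∷ H} {suc i} (s≤s p) = there (at-∈ p)

∈-at : ∀ {H E} → E ∈ H → ∃ λ i → i < length H × at H i ≡ E
∈-at (here refl) = 0 , s≤s z≤n , refl
∈-at (there E∈) with ∈-at E∈
... | i , i< , eq = suc i , s≤s i< , eq

at-injective : ∀ {H} → Unique H → ∀ {i j} → i < length H → j < length H → at H i ≡ at H j → i ≡ j
at-injective (_ ∷ _) {zero} {zero} _ _ _ = refl
at-injective (E∉ ∷ _) {zero} {suc j} _ (s≤s j<) eq = contradiction eq (All.lookup E∉ (at-∈ j<))
at-injective (E∉ ∷ _) {suc i} {zero} (s≤s i<) _ eq = contradiction (sym eq) (All.lookup E∉ (at-∈ i<))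
at-injective (_ ∷ uH) {suc i} {suc j} (s≤s i<) (s≤s j<) eq = cong suc (at-injective uH i< j< eq)

at-halves : ∀ b H i → at (map (halves b) H) i ≡ halves b (at H i)
at-halves b []      i       = sym (halves-[] b)
at-halves b (E ∷ H) zero    = refl
at-halves b (E ∷ H) (suc i) = at-halves b H i

slots : List Edge → ℕ → List ℕ
slots G v = filter (λ i → v ∈? at G i) (upTo (length G))

-- The entry of `f` at `p` is the rank of the block of `p` among the entries of `G` whose shadow
-- contains the interval of `p`; `label` turns it back into a position in `G`. Naming the block by
-- this local rank is what makes `2 ^ b` choices per point sufficient.
label : ∀ {n} → ℕ → List Edge → Vec ℕ n → Fin n → ℕ
label b G f p = nth (slots G (shift b (toℕ p))) (Vec.lookup f p)

kernel : ∀ {n} → (Fin n → ℕ) → Rel n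
kernel ℓ p q = does (ℓ p ≟ ℓ q)

matrix : ∀ {n} → Rel n → Vec (Vec Bool n) n
matrix R = Vec.tabulate λ p → Vec.tabulate (R p)

matrix-! : ∀ {n} (R : Rel n) p q → Vec.lookup (Vec.lookup (matrix R) p) q ≡ R p q
matrix-! R p q = trans (cong (λ v → Vec.lookup v q) (Vec.lookup∘tabulate (λ p → Vec.tabulate (R p)) p))
  (Vec.lookup∘tabulate (R p) q)

kernel-complete : ∀ {n} {R : Rel n} (ℓ : Fin n → ℕ) → (∀ {p q} → T (R p q) → ℓ p ≡ ℓ q) →
  (∀ {p q} → ℓ p ≡ ℓ q → T (R p q)) →
  ∀ p q → R p q ≡ kernel ℓ p q
kernel-complete {R = R} ℓ f g p q with ℓ p ≟ ℓ q
... | yes eq = trans (Equivalence.to T-≡ (g eq)) (sym (dec-true (ℓ p ≟ ℓ q) eq))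
... | no ≢ with R p q in Rpq
...   | false = sym (dec-false (ℓ p ≟ ℓ q) ≢)
...   | true  = contradiction (f (Equivalence.from T-≡ Rpq)) ≢

module Decoding {n} (R : Rel n) (equiv : IsEquivalenceᵇ R) where

  open IsEquivalenceᵇ equiv
  open Blocks R equiv

  module _ (b : ℕ) (Bl : List Edge) (Bl↭ : blocks ↭ Bl) where

    G = map (halves b) Bl

    Bl-unique : Unique Bl
    Bl-unique = Unique-resp-↭ Bl↭ blocks-unique

    Bl⁻ : ∀ {E} → E ∈ Bl → E ∈ blocks
    Bl⁻ = ↭.∈-resp-↭ (↭-sym Bl↭)

    index : ∀ p → ∃ λ i → i < length Bl × at Bl i ≡ block p
    index p = ∈-at (↭.∈-resp-↭ Bl↭ (blocks⁺ p))

    slots⁻ : ∀ {v i} → i ∈ slots G v → i < length Bl × v ∈ halves b (at Bl i)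
    slots⁻ {v} {i} i∈ with ∈-filter⁻ (λ i → v ∈? at G i) {xs = upTo (length G)} i∈
    ... | i∈upTo , v∈ = subst (i <_) (length-map (halves b) Bl) (∈-upTo⁻ i∈upTo) ,
        subst (v ∈_) (at-halves b Bl i) v∈

    -- The blocks meeting an interval of length 2 ^ b are disjoint, so there are at most 2 ^ b of them.
    length-slots : ∀ v → length (slots G v) ≤ 2 ^ b
    length-slots v = begin
      length (slots G v) ≤⟨ length≤fibres (λ i z → z ∈? at Bl i) 1 (slots G v) interval meets fibre ⟩
      1 * length interval ≡⟨ *-identityˡ _ ⟩
      length interval ≡⟨ trans (length-map (v * 2 ^ b +_) (upTo (2 ^ b))) (length-upTo (2 ^ b)) ⟩
      2 ^ b ∎
      where
      open ≤-Reasoning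
      interval : List ℕ
      interval = map (v * 2 ^ b +_) (upTo (2 ^ b))
      meets : ∀ {i} → i ∈ slots G v → Any (_∈ at Bl i) interval
      meets {i} i∈ with ∈-halves⁻ b {at Bl i} (proj₂ (slots⁻ i∈))
      ... | z , z∈ , refl with shift-range b z
      ...   | r , r< , eq = lose (∈-map⁺ (shift b z * 2 ^ b +_) (∈-upTo⁺ r<)) (subst (_∈ at Bl i) eq z∈)
      fibre : ∀ {z} → z ∈ interval → length (filter (λ i → z ∈? at Bl i) (slots G v)) ≤ 1
      fibre {z} _ = length≤1 (Unique.filter⁺ _ (Unique.filter⁺ _ (Unique.upTo⁺ (length G)))) λ i∈ j∈ →
        same (member i∈) (member j∈)
        where
        member : ∀ {i} → i ∈ filter (λ i → z ∈? at Bl i) (slots G v) → i < length Bl × z ∈ at Bl i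
        member i∈ with ∈-filter⁻ (λ i → z ∈? at Bl i) {xs = slots G v} i∈
        ... | i∈s , z∈ = proj₁ (slots⁻ i∈s) , z∈
        same : ∀ {i j} → i < length Bl × z ∈ at Bl i → j < length Bl × z ∈ at Bl j → i ≡ j
        same (i< , z∈i) (j< , z∈j) =
          at-injective Bl-unique i< j< (blocks-meet (Bl⁻ (at-∈ i<)) (Bl⁻ (at-∈ j<)) z∈i z∈j)

    index-∈ : ∀ p → proj₁ (index p) ∈ slots G (shift b (toℕ p))
    index-∈ p with index p
    ... | i , i< , eq = ∈-filter⁺ (λ i → shift b (toℕ p) ∈? at G i)
      (∈-upTo⁺ (subst (i <_) (sym (length-map (halves b) Bl)) i<))
      (subst (shift b (toℕ p) ∈_) (sym (trans (at-halves b Bl i) (cong (halves b) eq)))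
        (∈-halves⁺ b (∈-block⁺ (reflexive p))))

    slot : ∀ p → ∃ λ j →
      j < length (slots G (shift b (toℕ p))) × nth (slots G (shift b (toℕ p))) j ≡ proj₁ (index p)
    slot p = ∈-nth (index-∈ p)

    f : Vec ℕ n
    f = Vec.tabulate (proj₁ ∘ slot)

    f-∈ : f ∈ vectors (upTo (2 ^ b)) n
    f-∈ = ∈-box (λ _ → upTo (2 ^ b)) f λ p → ∈-upTo⁺
      (subst (_< 2 ^ b) (sym (Vec.lookup∘tabulate (proj₁ ∘ slot) p))
        (<-≤-trans (proj₁ (proj₂ (slot p))) (length-slots _)))

    label-index : ∀ p → label b G f p ≡ proj₁ (index p)
    label-index p = trans (cong (nth (slots G (shift b (toℕ p)))) (Vec.lookup∘tabulate (proj₁ ∘ slot) p))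
      (proj₂ (proj₂ (slot p)))

    decoded : ∀ p q → R p q ≡ kernel (label b G f) p q
    decoded = kernel-complete (label b G f) to from
      where
      to : ∀ {p q} → T (R p q) → label b G f p ≡ label b G f q
      to {p} {q} Rpq = trans (label-index p) (trans
        (at-injective Bl-unique (proj₁ (proj₂ (index p))) (proj₁ (proj₂ (index q)))
          (trans (proj₂ (proj₂ (index p))) (trans (block-≡ Rpq) (sym (proj₂ (proj₂ (index q)))))))
        (sym (label-index q)))
      from : ∀ {p q} → label b G f p ≡ label b G f q → T (R p q)
      from {p} {q} eq = block-≡⁻ (trans (sym (proj₂ (proj₂ (index p)))) (trans
        (cong (at Bl) (trans (sym (label-index p)) (trans eq (label-index q)))) (proj₂ (proj₂ (index q)))))

  -- The cover knows the shadows only up to reordering. The blocks are reordered to match, and the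
  -- ranks are taken with respect to that order.
  decode-complete : ∀ b {G} → G ↭ map (halves b) blocks →
    ∃ λ f → f ∈ vectors (upTo (2 ^ b)) n × ∀ p q → R p q ≡ kernel (label b G f) p q
  decode-complete b G↭ with ↭.↭-map-inv (halves b) (↭-sym G↭)
  ... | Bl , refl , Bl↭ = f b Bl Bl↭ , f-∈ b Bl Bl↭ , decoded b Bl Bl↭

  related? : ∀ i j → Dec (T (R i j))
  related? i j = T? (R i j)

  -- The least members of the blocks, as `deduplicate` keeps first occurrences.
  reps : List (Fin n)
  reps = deduplicate related? (allFin n)

  -- With `d = 0` the pattern asks for `m` distinct edges with increasing representatives, and the
  -- least members of `m` blocks, taken in order, are such.
  reps-pattern : ∀ {m σ} → (∀ i → σ 0 i ≡ i) → m ≤ length reps → ContainsPattern m 0 σ blocks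
  reps-pattern {m} {σ} σ-id m≤ = record
    { e = λ i → block (rep i)
    ; e∈ = λ i → blocks⁺ (rep i)
    ; distinct = λ i≢i′ eq → distinct i≢i′ (block-≡⁻ eq)
    ; x = λ i _ → toℕ (rep i)
    ; x∈ = λ i _ → ∈-block⁺ (reflexive (rep i))
    ; within = within
    ; across = λ { {zero} {zero} _ _ () }
    }
    where
    rep : Fin m → Fin n
    rep i = lookup reps (Fin.inject≤ i m≤)
    inject-mono : ∀ {i j} → i Fin.< j → Fin.inject≤ i m≤ Fin.< Fin.inject≤ j m≤
    inject-mono {i} {j} = subst₂ _<_ (sym (Fin.toℕ-inject≤ i m≤)) (sym (Fin.toℕ-inject≤ j m≤))
    within : ∀ l {i i′} → σ (toℕ l) i Fin.< σ (toℕ l) i′ → toℕ (rep i) < toℕ (rep i′)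
    within zero {i} {i′} lt = lookup-AllPairs (AllPairs-deduplicate related? (allFin-sorted n))
      (inject-mono (subst₂ Fin._<_ (σ-id i) (σ-id i′) lt))
    distinct : ∀ {i i′} → i ≢ i′ → ¬ T (R (rep i) (rep i′))
    distinct {i} {i′} i≢i′ Rii′ with Fin.<-cmp i i′
    ... | tri< lt _ _ = lookup-AllPairs (deduplicate-distinct related? (allFin n)) (inject-mono lt) Rii′
    ... | tri≈ _ eq _ = i≢i′ eq
    ... | tri> _ _ gt = lookup-AllPairs (deduplicate-distinct related? (allFin n)) (inject-mono gt)
        (symmetric Rii′)

  repIndex : Fin n → Fin (length reps)
  repIndex p = Any.index (deduplicate-covers related? (reflexive _) transitive (allFin n) (∈-allFin p))

  repIndex-R : ∀ p → T (R (lookup reps (repIndex p)) p)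
  repIndex-R p = Any.lookup-index (deduplicate-covers related? (reflexive _) transitive (allFin n) (∈-allFin p))

  reps-decoded : ∀ p q → R p q ≡ kernel (toℕ ∘ repIndex) p q
  reps-decoded = kernel-complete (toℕ ∘ repIndex) to from
    where
    to : ∀ {p q} → T (R p q) → toℕ (repIndex p) ≡ toℕ (repIndex q)
    to {p} {q} Rpq with Fin.<-cmp (repIndex p) (repIndex q)
    ... | tri≈ _ eq _ = cong toℕ eq
    ... | tri< lt _ _ = contradiction (transitive (repIndex-R p) (transitive Rpq (symmetric (repIndex-R q))))
                          (lookup-AllPairs (deduplicate-distinct related? (allFin n)) lt)
    ... | tri> _ _ gt = contradiction
        (transitive (repIndex-R q) (transitive (symmetric Rpq) (symmetric (repIndex-R p))))
                          (lookup-AllPairs (deduplicate-distinct related? (allFin n)) gt)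
    from : ∀ {p q} → toℕ (repIndex p) ≡ toℕ (repIndex q) → T (R p q)
    from {p} {q} eq = transitive (symmetric (repIndex-R p))
      (subst (λ i → T (R (lookup reps i) q)) (sym (Fin.toℕ-injective eq)) (repIndex-R q))

-- Counting the enumerated relations

allVecs-unique : ∀ k → Unique (allVecs k)
allVecs-unique zero = [] ∷ []
allVecs-unique (suc k) = Unique.concat⁺
  (All.map⁺ (All.tabulate {xs = allVecs k} λ _ → ((λ ()) ∷ []) ∷ [] ∷ []))
  (AllPairs.map⁺ (AllPairs.map disjoint (allVecs-unique k)))
  where
  tail-≡ : ∀ {v w : Vec Bool k} {z} → z ∈ (true ∷ v) ∷ (false ∷ v) ∷ [] → Vec.tail z ≡ v
  tail-≡ (here refl)         = refl
  tail-≡ (there (here refl)) = refl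
  disjoint : ∀ {v w : Vec Bool k} → v ≢ w → ∀ {z} →
    ¬ (z ∈ (true ∷ v) ∷ (false ∷ v) ∷ [] × z ∈ (true ∷ w) ∷ (false ∷ w) ∷ [])
  disjoint {v} {w} v≢w (z∈v , z∈w) = v≢w (trans (sym (tail-≡ {v} {v} z∈v)) (tail-≡ {w} {w} z∈w))

allVecVecs-unique : ∀ k l → Unique (allVecVecs k l)
allVecVecs-unique zero l = [] ∷ []
allVecVecs-unique (suc k) l = Unique.concat⁺
  (All.map⁺ (All.tabulate {xs = allVecVecs k l} λ _ → Unique.map⁺ Vec.∷-injectiveˡ (allVecs-unique l)))
  (AllPairs.map⁺ (AllPairs.map disjoint (allVecVecs-unique k l)))
  where
  disjoint : ∀ {v w : Vec (Vec Bool l) k} → v ≢ w → ∀ {z} →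
    ¬ (z ∈ map (_∷ v) (allVecs l) × z ∈ map (_∷ w) (allVecs l))
  disjoint {v} {w} v≢w (z∈v , z∈w) with ∈-map⁻ (_∷ v) z∈v | ∈-map⁻ (_∷ w) z∈w
  ... | _ , _ , refl | _ , _ , eq = v≢w (Vec.∷-injectiveʳ eq)

length-filter-map : ∀ {A C : Set} {P : C → Set} (P? : Decidable P) (g : A → C) xs →
  length (filter P? (map g xs)) ≡ length (filter (P? ∘ g) xs)
length-filter-map P? g [] = refl
length-filter-map P? g (x ∷ xs) with P? (g x)
... | yes _ = cong suc (length-filter-map P? g xs)
... | no  _ = length-filter-map P? g xs

T-not : ∀ {b} → T (not b) → ¬ T b
T-not {false} _ ()

-- Relations are functions, for which pointwise equality does not yield equality. The count is
-- therefore carried out on the matrices from which `allRels` is built: they are listed without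
-- repetition, and pointwise equal ones coincide.
B≤length : ∀ {M n} (π : Rel M) (ys : List (Vec (Vec Bool n) n)) →
  (∀ (R : Rel n) → IsEquivalenceᵇ R → ¬ Contains R π → ∃ λ Q → matrix Q ∈ ys × (∀ p q → R p q ≡ Q p q)) →
    B n π ≤ length ys
B≤length {M} {n} π ys covers = ≤-trans (≤-reflexive (length-filter-map P? g (allVecVecs n n)))
  (length-mono-⊆ (Unique.filter⁺ (P? ∘ g) (allVecVecs-unique n n)) sub)
  where
  P? : ∀ (R : Rel n) → Dec (T (isEquiv R ∧ not (contains R π)))
  P? R = T? (isEquiv R ∧ not (contains R π))
  g : Vec (Vec Bool n) n → Rel n
  g v i j = Vec.lookup (Vec.lookup v i) j
  sub : ∀ {v} → v ∈ filter (P? ∘ g) (allVecVecs n n) → v ∈ ys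
  sub {v} v∈ with Equivalence.to (T-∧ {isEquiv (g v)}) (proj₂ (∈-filter⁻ (P? ∘ g) {xs = allVecVecs n n} v∈))
  ... | eqv , ¬c with covers (g v) (isEquiv⇒ eqv) (T-not ¬c)
  ...   | Q , Q∈ , eq = subst (_∈ ys)
      (sym (vec-ext v (matrix Q) λ p → vec-ext _ _ λ q → trans (eq p q) (sym (matrix-! Q p q)))) Q∈

-- A partition with at least `m` blocks contains `m` singletons. An avoiding one thus has fewer than
-- `m` blocks and is given by a word over `m` letters.
B≤zero-layers : ∀ {M} (π : Rel M) {m} (σs : Vec (Permutation′ m) 0) → Contains (permPartition σs) π → ∀ n →
  B n π ≤ m ^ n
B≤zero-layers π {m} σs σs⊒π n = begin
  B n π ≤⟨ B≤length π ys covers ⟩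
  length ys ≡⟨ length-map (λ f → matrix (kernel (Vec.lookup f))) (vectors (upTo m) n) ⟩
  length (vectors (upTo m) n) ≤⟨ length-vectors (upTo m) n ⟩
  length (upTo m) ^ n ≡⟨ cong (_^ n) (length-upTo m) ⟩
  m ^ n ∎
  where
  open ≤-Reasoning
  ys = map (λ f → matrix (kernel (Vec.lookup f))) (vectors (upTo m) n)
  covers : ∀ (R : Rel n) → IsEquivalenceᵇ R → ¬ Contains R π → ∃ λ Q → matrix Q ∈ ys × (∀ p q → R p q ≡ Q p q)
  covers R equiv av = kernel (Vec.lookup ranks) , ∈-map⁺ _ ranks∈ , λ p q →
    trans (reps-decoded p q) (cong₂ (λ a b → does (a ≟ b)) (sym (ranks-! p)) (sym (ranks-! q)))
    where
    open Decoding R equiv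
    few : length reps < m
    few = ≰⇒> λ m≤ → av (Contains-trans {R = R} {permPartition σs} {π}
      (Blocks.pattern⇒contains R equiv σs (reps-pattern (λ _ → refl) m≤)) σs⊒π)
    ranks = Vec.tabulate (toℕ ∘ repIndex)
    ranks-! : ∀ p → Vec.lookup ranks p ≡ toℕ (repIndex p)
    ranks-! = Vec.lookup∘tabulate (toℕ ∘ repIndex)
    ranks∈ : ranks ∈ vectors (upTo m) n
    ranks∈ = ∈-box (λ _ → upTo m) ranks λ p →
      ∈-upTo⁺ (subst (_< m) (sym (ranks-! p)) (<-trans (Fin.toℕ<n (repIndex p)) few))

-- Choice of the scales and the final estimate

^-exponent : ∀ x e n → (x ^ e) ^ n ≡ x ^ (n * e)
^-exponent x e n = trans (^-*-assoc x e n) (cong (x ^_) (*-comm e n))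

^-swap : ∀ x e f → (x ^ e) ^ f ≡ (x ^ f) ^ e
^-swap x e f = trans (^-*-assoc x e f) (sym (^-exponent x f e))

-- Roots are avoided by taking `d`-th powers: the hypothesis on `ℓ` says that it is at most `t`
-- times n^(1-1/d), where `d′` plays the role of d - 1.
combine-powers : ∀ G t ℓ n d d′ {β} → β ≤ G ^ n * ℓ ^ n → ℓ ^ d ≤ t ^ d * n ^ d′ →
  β ^ d ≤ (G * t) ^ (n * d) * n ^ (n * d′)
combine-powers G t ℓ n d d′ {β} β≤ ℓ≤ = begin
  β ^ d ≤⟨ ^-monoˡ-≤ d β≤ ⟩
  (G ^ n * ℓ ^ n) ^ d ≡⟨ ^-distribʳ-* d (G ^ n) (ℓ ^ n) ⟩
  (G ^ n) ^ d * (ℓ ^ n) ^ d ≡⟨ cong₂ _*_ (^-*-assoc G n d) (^-swap ℓ n d) ⟩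
  G ^ (n * d) * (ℓ ^ d) ^ n ≤⟨ *-monoʳ-≤ (G ^ (n * d)) (^-monoˡ-≤ n ℓ≤) ⟩
  G ^ (n * d) * (t ^ d * n ^ d′) ^ n
    ≡⟨ cong (G ^ (n * d) *_) (trans (^-distribʳ-* n (t ^ d) (n ^ d′))
      (cong₂ _*_ (^-exponent t d n) (^-exponent n d′ n))) ⟩
  G ^ (n * d) * (t ^ (n * d) * n ^ (n * d′)) ≡⟨ *-assoc (G ^ (n * d)) (t ^ (n * d)) _ ⟨
  G ^ (n * d) * t ^ (n * d) * n ^ (n * d′) ≡⟨ cong (_* n ^ (n * d′)) (^-distribʳ-* (n * d) G t) ⟨
  (G * t) ^ (n * d) * n ^ (n * d′) ∎
  where open ≤-Reasoning

module CoverArithmetic (β : ℕ → ℕ) (d′ g : ℕ)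
  (β≤ : ∀ {n a b} → (2 ^ a) ^ suc d′ ≤ n → n ≤ 2 ^ (b + suc a) → β n ≤ 2 ^ (g * n) * (2 ^ b) ^ n) where

  d = suc d′

  -- `2 ^ g` is the cost of the shadows per point, and 2 is the constant lost in `interval-length`.
  c : ℕ
  c = 2 ^ g * 2

  -- At most 2n points are cut into `2 ^ suc a` intervals, and this number exceeds n^(1/d); so an
  -- interval has length less than 2 n^(1-1/d).
  interval-length : ∀ {n a J} → 1 ≤ n → n < (2 ^ suc a) ^ d → 2 ^ J ≤ 2 * n →
    (2 ^ (J ∸ suc a)) ^ d ≤ 2 ^ d * n ^ d′
  interval-length {n} {a} {J} 1≤n n< J≤ with suc a ≤? J
  -- Truncated subtraction makes the interval length `2 ^ 0` here.
  ... | no ≰ rewrite m≤n⇒m∸n≡0 (<⇒≤ (≰⇒> ≰)) | ^-zeroˡ d = *-mono-≤ (m^n>0 2 d) (m^n>0 n ⦃ >-nonZero 1≤n ⦄ d′)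
  ... | yes ≤J = *-cancelʳ-≤ _ _ n ⦃ >-nonZero 1≤n ⦄ (begin
    (2 ^ b) ^ d * n                ≤⟨ *-monoʳ-≤ ((2 ^ b) ^ d) (<⇒≤ n<) ⟩
    (2 ^ b) ^ d * (2 ^ suc a) ^ d  ≡⟨ ^-distribʳ-* d (2 ^ b) (2 ^ suc a) ⟨
    (2 ^ b * 2 ^ suc a) ^ d        ≡⟨ cong (_^ d) (^-distribˡ-+-* 2 b (suc a)) ⟨
    (2 ^ (b + suc a)) ^ d          ≡⟨ cong (λ e → (2 ^ e) ^ d) (m∸n+n≡m ≤J) ⟩
    (2 ^ J) ^ d                    ≤⟨ ^-monoˡ-≤ d J≤ ⟩
    (2 * n) ^ d                    ≡⟨ ^-distribʳ-* d 2 n ⟩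
    2 ^ d * (n * n ^ d′)           ≡⟨ rotate (2 ^ d) n (n ^ d′) ⟩
    2 ^ d * n ^ d′ * n             ∎)
    where
    open ≤-Reasoning
    b = J ∸ suc a
    rotate : ∀ x n y → x * (n * y) ≡ x * y * n
    rotate = solve-∀

  size-power : ∀ a → (2 ^ a) ^ d ≡ (2 ^ d) ^ a
  size-power a = ^-swap 2 a d

  bound : ∀ n → 1 ≤ n → β n ^ d ≤ c ^ (n * d) * n ^ (n * d′)
  -- `2 ^ a` replaces n^(1/d): bracketing `n` between powers of `2 ^ d` is an integral form of the
  -- root. `2 ^ suc J` is `n` rounded up to a power of two, to be cut into `2 ^ suc a` intervals of
  -- length `2 ^ b`.
  bound n 1≤n with power-bracket (2 ^ d) (^-monoʳ-< 2 (s≤s (s≤s z≤n)) {0} {d} (s≤s z≤n)) n 1≤n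
    | power-bracket 2 (s≤s (s≤s z≤n)) n 1≤n
  ... | a , lo , hi | J , lo′ , hi′ = combine-powers (2 ^ g) 2 (2 ^ b) n d d′
    (≤-trans (β≤ {n} {a} {b} (≤-trans (≤-reflexive (size-power a)) lo) n≤)
      (*-monoˡ-≤ ((2 ^ b) ^ n) (≤-reflexive (sym (^-*-assoc 2 g n)))))
    (interval-length {n} {a} {suc J} 1≤n (<-≤-trans hi (≤-reflexive (sym (size-power (suc a))))) (*-monoʳ-≤ 2 lo′))
    where
    b = suc J ∸ suc a
    n≤ : n ≤ 2 ^ (b + suc a)
    n≤ = ≤-trans (<⇒≤ hi′) (^-monoʳ-≤ 2 (≤-trans (m≤n+m∸n (suc J) (suc a)) (≤-reflexive (+-comm (suc a) b))))

module Counting {M} (π : Rel M) (m′ d′ : ℕ) (σs : Vec (Permutation′ (suc m′)) (suc d′))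
  (σs⊒π : Contains (permPartition σs) π) where

  open Covers m′ d′ (order σs) (λ _ → refl)

  B≤cover : ∀ {n a b} → size a ≤ n → n ≤ 2 ^ (b + suc a) → B n π ≤ 2 ^ ((Γ + 4) * n) * (2 ^ b) ^ n
  B≤cover {n} {a} {b} size≤ n≤ = begin
    B n π ≤⟨ B≤length {n = n} π ys covers ⟩
    length ys ≡⟨ length-cartesianProductWith recover (finalCover n a) (vectors (upTo (2 ^ b)) n) ⟩
    length (finalCover n a) * length (vectors (upTo (2 ^ b)) n)
      ≤⟨ *-mono-≤ (length-finalCover {n} {a} size≤)
        (≤-trans (length-vectors (upTo (2 ^ b)) n) (≤-reflexive (cong (_^ n) (length-upTo (2 ^ b))))) ⟩
    2 ^ ((Γ + 4) * n) * (2 ^ b) ^ n ∎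
    where
    open ≤-Reasoning
    recover : List Edge → Vec ℕ n → Vec (Vec Bool n) n
    recover G f = matrix (kernel (label b G f))
    ys = cartesianProductWith recover (finalCover n a) (vectors (upTo (2 ^ b)) n)
    covers : ∀ (R : Rel n) → IsEquivalenceᵇ R → ¬ Contains R π → ∃ λ Q → matrix Q ∈ ys × (∀ p q → R p q ≡ Q p q)
    covers R equiv av = kernel (label b G f) , ∈-cartesianProductWith⁺ recover G∈ f∈ , eq
      where
      open Blocks R equiv
      H = map (halves b) blocks
      family-member : ∃ λ G → G ∈ finalCover n a × G ↭ H
      family-member = finalCover-complete {n} {a} (halves-hypergraph b {suc a} (blocks-hypergraph n≤))
        (λ cp → av (Contains-trans {R = R} {permPartition σs} {π}
          (pattern⇒contains σs (halves-contains b cp)) σs⊒π))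
        (≤-trans (weight-halves b blocks) weight-blocks)
      G = proj₁ family-member
      G∈ = proj₁ (proj₂ family-member)
      code : ∃ λ f → f ∈ vectors (upTo (2 ^ b)) n × ∀ p q → R p q ≡ kernel (label b G f) p q
      code = Decoding.decode-complete R equiv b (proj₂ (proj₂ family-member))
      f = proj₁ code
      f∈ = proj₁ (proj₂ code)
      eq = proj₂ (proj₂ code)

  open CoverArithmetic (λ n → B n π) d′ (Γ + 4) (λ {n} {a} {b} → B≤cover {n} {a} {b}) public using (c; bound)

no-points : ∀ {d} → ¬ Fin (suc d * 0)
no-points {d} q with () ← proj₂ (Fin.remQuot {suc d} 0 q)

-- For `m = 0` the partition `[σ₁,…,σ_d]` has no points, so every partition contains it, and with it
-- `π`.
B-empty : ∀ {M} (π : Rel M) {d} (σs : Vec (Permutation′ 0) d) → Contains (permPartition σs) π → ∀ n → B n π ≤ 0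
B-empty π {d} σs σs⊒π n = B≤length {n = n} π [] λ R equiv av → contradiction
  (Contains-trans {R = R} {permPartition σs} {π}
    (contains-mono {R = R} {permPartition σs} (⊥-elim ∘ no-points {d}) (λ {i} _ → ⊥-elim (no-points {d} i))
      (λ i _ → ⊥-elim (no-points {d} i)))
    σs⊒π) av

B-bound : ∀ {M} (π : Rel M) {m d′} (σs : Vec (Permutation′ m) (suc d′)) → Contains (permPartition σs) π →
  ∃ λ c → ∀ n → 1 ≤ n → B n π ^ suc d′ ≤ c ^ (n * suc d′) * n ^ (n * d′)
B-bound π {zero} {d′} σs σs⊒π = 0 , λ n _ → ≤-trans (^-monoˡ-≤ (suc d′) (B-empty π σs σs⊒π n)) z≤n
B-bound π {suc m′} {d′} σs σs⊒π = Counting.c π m′ d′ σs σs⊒π , Counting.bound π m′ d′ σs σs⊒π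

theorem3p2 : ∀ {M} (π : SetPartition M) (d : ℕ) → IsPm (proj₁ π) d →
    ((1 ≤ d → Σ ℕ (λ c → ∀ n → 1 ≤ n →
    B n (proj₁ π) ^ d ≤ c ^ (n * d) * n ^ (n * (d ∸ 1))))
    × (d ≡ 0 → Σ ℕ (λ c → ∀ n → B n (proj₁ π) ≤ c ^ n)))
theorem3p2 (π , _) zero     ((m , σs , σs⊒π) , _) = (λ ()) , λ _ → m , B≤zero-layers π σs σs⊒π
theorem3p2 (π , _) (suc d′) ((_ , σs , σs⊒π) , _) = (λ _ → B-bound π σs σs⊒π) , λ ()
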